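{- Suppose $f \colon \mathbb{N} \to [0,\infty)$ is a sub-identical order function and $h,\hat{h}\colon \mathbb{N} \to [0,\infty)$ are order functions such that $\sum_{n=0}^\infty 2^{ -h(n)} < \infty$, $\sum_{n=0}^\infty 2^{ -\hat{h}(n)} < \infty$, and $\lim_{n \to \infty}(h(n) - \hat{h}(n)) = \infty$. Then $$\mathrm{LUA}\bigl(\lambda n.\, \exp_2\bigl(f^{\mathrm{inv}}(h(n))+1\bigr)\bigr) \leq_{\mathrm{s}} \mathrm{COMPLEX}(f).$$
   Context: $\exp_2(x)=2^x$. An order function is a computable (i.e. its values are uniformly computable reals), nondecreasing, unbounded function $\mathbb{N}\to\mathbb{R}$. A function $f\colon\mathbb{N}\to[0,\infty)$ is sub-identical if $\lim_{n\to\infty}(n-f(n))=\infty$. For nondecreasing unbounded $f\colon\mathbb{N}\to\mathbb{R}$, $f^{\mathrm{inv}}\colon\mathbb{R}\to\mathbb{N}$ is defined by $f^{\mathrm{inv}}(x)=$ the least $m\in\mathbb{N}$ with $f(m)\geq x$. Prefix-free complexity: a prefix-free machine is a partial recursive $M$ from $\{0,1\}^*$ to $\{0,1\}^*$ with prefix-free domain; $U$ is universal if for each prefix-free machine $M$ there is $\rho$ with $U(\rho^\frown\tau)\simeq M(\tau)$ for all $\tau$. Fix a universal $U$ and let $K(\sigma)=\min\{|\tau| : U(\tau)=\sigma\}$. For $f\colon\mathbb{N}\to\mathbb{R}$, $\mathrm{COMPLEX}(f)$ is the set of $X\in\{0,1\}^{\mathbb{N}}$ for which there is $c\in\mathbb{N}$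 with $K(X\upharpoonright n)\geq f(n)-c$ for all $n$. A partial recursive $\psi\colon\subseteq\mathbb{N}\to\mathbb{N}$ is linearly universal if for every partial recursive $\theta\colon\subseteq\mathbb{N}\to\mathbb{N}$ there are $a,b\in\mathbb{N}$ with $\psi(ax+b)\simeq\theta(x)$ for all $x$. For $p\colon\mathbb{N}\to(1,\infty)$, $\mathrm{LUA}(p)$ is the set of $X\in\mathbb{N}^{\mathbb{N}}$ such that $X(n)<p(n)$ for all $n$ and, for some linearly universal partial recursive $\psi$, there is no $n\in\operatorname{dom}\psi$ with $X(n)=\psi(n)$. For $P,Q\subseteq\mathbb{N}^{\mathbb{N}}$, $P\leq_{\mathrm{s}}Q$ means there is a partial recursive functional defined on all of $Q$ that maps $Q$ into $P$. -}

module Defs where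

open import Level using (0ℓ)
open import Axiom.ExcludedMiddle using (ExcludedMiddle)
open import Data.Bool.Base using (Bool; true; false)
open import Data.Empty using (⊥; ⊥-elim)
open import Data.Fin.Base using (Fin)
open import Data.Integer.Base as ℤ using (ℤ; +_; -[1+_])
import Data.Integer.Properties as ℤ
open import Data.List.Base using (List; []; _∷_; _++_; length; applyUpTo)
open import Data.List.Relation.Binary.Prefix.Heterogeneous using (Prefix)
open import Data.Nat.Base as ℕ using (ℕ; zero; suc)
import Data.Nat.Properties as ℕ
open import Data.Product.Base using (∃; _×_; _,_; proj₁; proj₂)
open import Data.Rational.Base as ℚ using (ℚ; 0ℚ; 1ℚ; ½; ↥_; ↧ₙ_)
import Data.Rational.Properties as ℚ
open import Data.Sum.Base using (_⊎_; inj₁; inj₂)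
open import Data.Unit.Base using (⊤; tt)
open import Data.Vec.Base using (Vec; []; _∷_; lookup)
open import Data.Vec.Relation.Binary.Pointwise.Inductive using (Pointwise)
open import Function.Bundles using (_⇔_)
open import Induction.WellFounded using (Acc; acc)
open import Data.Nat.Induction using (<-wellFounded)
open import Relation.Binary.PropositionalEquality
  using (_≡_; refl; sym; trans; cong; subst; subst₂)
open import Relation.Nullary using (¬_; yes; no)
open import Relation.Unary using (Pred; _∈_)
open import Algebra.Definitions.RawSemiring ℚ.+-*-rawSemiring using (_^_)
open import Algebra.Bundles using (CommutativeRing)
open import Algebra.Properties.Semiring.Exp
  (CommutativeRing.semiring ℚ.+-*-commutativeRing) using (^-assocʳ; ^-homo-*)
open import Algebra.Properties.Group ℚ.+-0-group using (⁻¹-involutive)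

IsLeast : (ℕ → Set) → ℕ → Set
IsLeast P m = P m × (∀ n → P n → m ℕ.≤ n)

least : ExcludedMiddle 0ℓ → (P : ℕ → Set) → ∃ P → ∃ (IsLeast P)
least em P (n , Pn) = go n Pn (<-wellFounded n)
  where
  go : ∀ n → P n → Acc ℕ._<_ n → ∃ (IsLeast P)
  go n Pn (acc rs) with ℕ.anyUpTo? (λ _ → em) n
  ... | yes (k , k<n , Pk) = go k Pk (rs k<n)
  ... | no ¬smaller = n , Pn , λ k Pk → ℕ.≮⇒≥ (λ k<n → ¬smaller (k , k<n , Pk))

-- Kleene's schemata, with an additional initial function  oracle i  for each
-- i : I.  I = ⊥ gives the partial recursive functions, I = ⊤ the partial
-- recursive functionals of one argument in Baire space.
data Code (I : Set) : ℕ → Set where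
  zer    : ∀ {n} → Code I n
  suc    : Code I 1
  proj   : ∀ {n} → Fin n → Code I n
  oracle : I → Code I 1
  comp   : ∀ {m n} → Code I m → Vec (Code I n) m → Code I n
  prec   : ∀ {n} → Code I n → Code I (suc (suc n)) → Code I (suc n)
  μ      : ∀ {n} → Code I (suc n) → Code I n

infix 4 _⊢_·_⇓_

data _⊢_·_⇓_ {I : Set} (Φ : I → ℕ → ℕ) : ∀ {n} → Code I n → Vec ℕ n → ℕ → Set where
  ⇓zer    : ∀ {n} {xs : Vec ℕ n} → Φ ⊢ zer · xs ⇓ 0
  ⇓suc    : ∀ {x} → Φ ⊢ suc · x ∷ [] ⇓ suc x
  ⇓proj   : ∀ {n} {i : Fin n} {xs} → Φ ⊢ proj i · xs ⇓ lookup xs i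
  ⇓oracle : ∀ {i x} → Φ ⊢ oracle i · x ∷ [] ⇓ Φ i x
  ⇓comp   : ∀ {m n} {f : Code I m} {gs : Vec (Code I n) m} {xs ys z} →
            Pointwise (λ g y → Φ ⊢ g · xs ⇓ y) gs ys →
            Φ ⊢ f · ys ⇓ z →
            Φ ⊢ comp f gs · xs ⇓ z
  ⇓prec₀  : ∀ {n} {f : Code I n} {g xs y} →
            Φ ⊢ f · xs ⇓ y →
            Φ ⊢ prec f g · 0 ∷ xs ⇓ y
  ⇓precₛ  : ∀ {n} {f : Code I n} {g k xs y z} →
            Φ ⊢ prec f g · k ∷ xs ⇓ y →
            Φ ⊢ g · k ∷ y ∷ xs ⇓ z →
            Φ ⊢ prec f g · suc k ∷ xs ⇓ z
  ⇓μ      : ∀ {n} {f : Code I (suc n)} {xs m} →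
            Φ ⊢ f · m ∷ xs ⇓ 0 →
            (∀ k → k ℕ.< m → ∃ λ y → Φ ⊢ f · k ∷ xs ⇓ suc y) →
            Φ ⊢ μ f · xs ⇓ m

-- Partial functions are represented by their graphs.
infixr 0 _⇀_
_⇀_ : Set → Set → Set₁
A ⇀ B = A → B → Set

infix 4 _≃_
_≃_ : {B : Set} → (B → Set) → (B → Set) → Set
P ≃ Q = ∀ y → P y ⇔ Q y

noOracle : ⊥ → ℕ → ℕ
noOracle ()

φ : Code ⊥ 1 → ℕ ⇀ ℕ
φ e x y = noOracle ⊢ e · x ∷ [] ⇓ y

Recursive₂ : (ℕ → ℕ → ℕ) → Set
Recursive₂ g = ∃ λ (e : Code ⊥ 2) → ∀ x y → noOracle ⊢ e · x ∷ y ∷ [] ⇓ g x y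

infix 4 _≤ₛ_
_≤ₛ_ : Pred (ℕ → ℕ) 0ℓ → Pred (ℕ → ℕ) 0ℓ → Set
P ≤ₛ Q = ∃ λ (e : Code ⊤ 1) → ∀ X → X ∈ Q →
         ∃ λ Y → Y ∈ P × (∀ n → (λ _ → X) ⊢ e · n ∷ [] ⇓ Y n)

-- A real is the open lower cut  { q ∈ ℚ | q < x }  it determines.
-- Such cuts are the classical Dedekind reals; constructively they need not be
-- located.
record ℝ : Set₁ where
  field
    below     : ℚ → Set
    inhabited : ∃ below
    bounded   : ∃ λ q → ¬ below q
    down      : ∀ {p q} → p ℚ.≤ q → below q → below p
    open′     : ∀ {p} → below p → ∃ λ q → p ℚ.< q × below q

open ℝ

infix 4 _≤_ _<_
_≤_ : ℝ → ℝ → Set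
x ≤ y = ∀ q → below x q → below y q

_<_ : ℝ → ℝ → Set
x < y = ∃ λ q → below y q × ¬ below x q

module Cut-lemmas where
  p<p+1 : ∀ p → p ℚ.< p ℚ.+ 1ℚ
  p<p+1 p = subst (ℚ._< p ℚ.+ 1ℚ) (ℚ.+-identityʳ p)
              (ℚ.+-monoʳ-< p (ℚ.positive⁻¹ 1ℚ))

  p-1<p : ∀ p → p ℚ.- 1ℚ ℚ.< p
  p-1<p p = subst (p ℚ.- 1ℚ ℚ.<_) (ℚ.+-identityʳ p)
              (ℚ.+-monoʳ-< p (ℚ.negative⁻¹ (ℚ.- 1ℚ)))

  p+[q-p]≡q : ∀ p q → p ℚ.+ (q ℚ.- p) ≡ q
  p+[q-p]≡q p q = trans (ℚ.+-comm p (q ℚ.- p))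
    (trans (ℚ.+-assoc q (ℚ.- p) p)
    (trans (cong (q ℚ.+_) (ℚ.+-inverseˡ p)) (ℚ.+-identityʳ q)))

  [p+q]-p≡q : ∀ p q → (p ℚ.+ q) ℚ.- p ≡ q
  [p+q]-p≡q p q = trans (cong (ℚ._- p) (ℚ.+-comm p q))
    (trans (ℚ.+-assoc q p (ℚ.- p))
    (trans (cong (q ℚ.+_) (ℚ.+-inverseʳ p)) (ℚ.+-identityʳ q)))

  neg-neg : ∀ p → ℚ.- (ℚ.- p) ≡ p
  neg-neg = ⁻¹-involutive

  below⇒< : ∀ x {p q} → below x p → ¬ below x q → p ℚ.< q
  below⇒< x p∈ q∉ = ℚ.≰⇒> (λ q≤p → q∉ (down x q≤p p∈))

open Cut-lemmas

fromℚ : ℚ → ℝ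
below     (fromℚ q)     = ℚ._< q
inhabited (fromℚ q)     = q ℚ.- 1ℚ , p-1<p q
bounded   (fromℚ q)     = q , ℚ.<-irrefl refl
down      (fromℚ q)     = ℚ.≤-<-trans
open′     (fromℚ q) p<q with m , p<m , m<q ← ℚ.<-dense p<q = m , p<m , m<q

fromℕ : ℕ → ℝ
fromℕ n = fromℚ (+ n ℚ./ 1)

0ℝ : ℝ
0ℝ = fromℚ 0ℚ

infixl 6 _+_ _-_
infix  8 -_

-- r < x + y  iff  r = s + (r - s) for some s < x with r - s < y.
_+_ : ℝ → ℝ → ℝ
below (x + y) r = ∃ λ s → below x s × below y (r ℚ.- s)
inhabited (x + y) with s , s∈ ← inhabited x | t , t∈ ← inhabited y =
  s ℚ.+ t , s , s∈ , subst (below y) (sym ([p+q]-p≡q s t)) t∈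
bounded (x + y) with b , b∉ ← bounded x | c , c∉ ← bounded y =
  b ℚ.+ c , λ { (s , s∈ , t∈) → ℚ.<-irrefl refl
    (subst (ℚ._< b ℚ.+ c) (p+[q-p]≡q s (b ℚ.+ c))
      (ℚ.+-mono-< (below⇒< x s∈ b∉) (below⇒< y t∈ c∉))) }
down (x + y) p≤q (s , s∈ , t∈) = s , s∈ , down y (ℚ.+-monoˡ-≤ (ℚ.- s) p≤q) t∈
open′ (x + y) {p} (s , s∈ , t∈) with t , <t , t∈′ ← open′ y t∈ =
  s ℚ.+ t
  , subst (ℚ._< s ℚ.+ t) (p+[q-p]≡q s p) (ℚ.+-monoʳ-< s <t)
  , s , s∈ , subst (below y) (sym ([p+q]-p≡q s t)) t∈′

-- r < - x  iff  x ≤ - s for some s > r.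
-_ : ℝ → ℝ
below (- x) r = ∃ λ s → r ℚ.< s × ¬ below x (ℚ.- s)
inhabited (- x) with b , b∉ ← bounded x =
  ℚ.- b ℚ.- 1ℚ , ℚ.- b , p-1<p (ℚ.- b) , subst (λ z → ¬ below x z) (sym (neg-neg b)) b∉
bounded (- x) with q , q∈ ← inhabited x =
  ℚ.- q , λ { (s , -q<s , -s∉) → -s∉
    (down x (ℚ.<⇒≤ (subst (ℚ.- s ℚ.<_) (neg-neg q) (ℚ.neg-antimono-< -q<s))) q∈) }
down (- x) p≤q (s , q<s , -s∉) = s , ℚ.≤-<-trans p≤q q<s , -s∉
open′ (- x) (s , p<s , -s∉) with m , p<m , m<s ← ℚ.<-dense p<s =
  m , p<m , s , m<s , -s∉

_-_ : ℝ → ℝ → ℝ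
x - y = x + - y

2ℚ : ℚ
2ℚ = + 2 ℚ./ 1

infix 9 2^ℤ_
2^ℤ_ : ℤ → ℚ
2^ℤ (+ n)    = 2ℚ ^ n
2^ℤ -[1+ n ] = ½ ^ suc n

module Power-lemmas where
  0≤^ : ∀ {r} → 0ℚ ℚ.≤ r → ∀ n → 0ℚ ℚ.≤ r ^ n
  0≤^ 0≤r zero    = ℚ.nonNegative⁻¹ 1ℚ
  0≤^ {r} 0≤r (suc n) = subst (ℚ._≤ r ℚ.* r ^ n) (ℚ.*-zeroʳ r)
    (ℚ.*-monoˡ-≤-nonNeg r ⦃ ℚ.nonNegative 0≤r ⦄ (0≤^ 0≤r n))

  *-mono-≤₀ : ∀ {p q r s} → 0ℚ ℚ.≤ q → 0ℚ ℚ.≤ r → p ℚ.≤ q → r ℚ.≤ s → p ℚ.* r ℚ.≤ q ℚ.* s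
  *-mono-≤₀ {q = q} {r = r} 0≤q 0≤r p≤q r≤s = ℚ.≤-trans
    (ℚ.*-monoʳ-≤-nonNeg r ⦃ ℚ.nonNegative 0≤r ⦄ p≤q)
    (ℚ.*-monoˡ-≤-nonNeg q ⦃ ℚ.nonNegative 0≤q ⦄ r≤s)

  ^-mono : ∀ {r s} → 0ℚ ℚ.≤ r → r ℚ.≤ s → ∀ n → r ^ n ℚ.≤ s ^ n
  ^-mono 0≤r r≤s zero    = ℚ.≤-refl
  ^-mono 0≤r r≤s (suc n) =
    *-mono-≤₀ (ℚ.≤-trans 0≤r r≤s) (0≤^ 0≤r n) r≤s (^-mono 0≤r r≤s n)

  0≤2 : 0ℚ ℚ.≤ 2ℚ
  0≤2 = ℚ.nonNegative⁻¹ 2ℚ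

  1≤2^ : ∀ n → 1ℚ ℚ.≤ 2ℚ ^ n
  1≤2^ zero    = ℚ.≤-refl
  1≤2^ (suc n) = *-mono-≤₀ 0≤2 (ℚ.nonNegative⁻¹ 1ℚ) 1≤2 (1≤2^ n)
    where
    1≤2 : 1ℚ ℚ.≤ 2ℚ
    1≤2 = ℚ.*≤* (ℤ.+≤+ (ℕ.s≤s ℕ.z≤n))

  ½^≤1 : ∀ n → ½ ^ n ℚ.≤ 1ℚ
  ½^≤1 zero    = ℚ.≤-refl
  ½^≤1 (suc n) = *-mono-≤₀ (ℚ.nonNegative⁻¹ 1ℚ) (0≤^ (ℚ.nonNegative⁻¹ ½) n) ½≤1 (½^≤1 n)
    where
    ½≤1 : ½ ℚ.≤ 1ℚ
    ½≤1 = ℚ.*≤* (ℤ.+≤+ (ℕ.s≤s ℕ.z≤n))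

  2^-mono : ∀ {m n} → m ℕ.≤ n → 2ℚ ^ m ℚ.≤ 2ℚ ^ n
  2^-mono {m} {n} m≤n = subst₂ ℚ._≤_ (ℚ.*-identityʳ (2ℚ ^ m))
    (trans (sym (^-homo-* 2ℚ m (n ℕ.∸ m))) (cong (2ℚ ^_) (ℕ.m+[n∸m]≡n m≤n)))
    (ℚ.*-monoˡ-≤-nonNeg (2ℚ ^ m) ⦃ ℚ.nonNegative (0≤^ 0≤2 m) ⦄ (1≤2^ (n ℕ.∸ m)))

  0<½^ : ∀ n → 0ℚ ℚ.< ½ ^ n
  0<½^ zero    = ℚ.positive⁻¹ 1ℚ
  0<½^ (suc n) = subst (ℚ._< ½ ℚ.* ½ ^ n) (ℚ.*-zeroʳ ½) (ℚ.*-monoʳ-<-pos ½ (0<½^ n))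

  0<2^ℤ : ∀ i → 0ℚ ℚ.< 2^ℤ i
  0<2^ℤ (+ n)    = ℚ.<-≤-trans (ℚ.positive⁻¹ 1ℚ) (1≤2^ n)
  0<2^ℤ -[1+ n ] = 0<½^ (suc n)

  2^ℤ≤ : ∀ {i n} → i ℤ.≤ + n → 2^ℤ i ℚ.≤ 2ℚ ^ n
  2^ℤ≤ {+ m}      {n} (ℤ.+≤+ m≤n) = 2^-mono m≤n
  2^ℤ≤ { -[1+ m ]} {n} _          = ℚ.≤-trans (½^≤1 (suc m)) (1≤2^ n)

  num≤ : ∀ {q b} → q ℚ.< b → ↥ q ℤ.≤ + (ℤ.∣ ↥ b ∣ ℕ.* ↧ₙ q)
  num≤ {ℚ.mkℚ -[1+ _ ] _ _} _ = ℤ.-≤+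
  num≤ {ℚ.mkℚ (+ k) d _} {ℚ.mkℚ (+ l) e _} (ℚ.*<* k*e<l*d) =
    ℤ.+≤+ (ℕ.≤-trans (ℕ.m≤m*n k (suc e))
      (ℕ.<⇒≤ (ℤ.drop‿+<+ (subst₂ ℤ._<_ (sym (ℤ.pos-* k (suc e))) (sym (ℤ.pos-* l (suc d))) k*e<l*d))))
  num≤ {ℚ.mkℚ (+ k) d _} {ℚ.mkℚ -[1+ l ] e _} (ℚ.*<* k*e<l*d)
    with () ← subst (ℤ._< -[1+ l ] ℤ.* + suc d) (sym (ℤ.pos-* k (suc e))) k*e<l*d

  divide : ∀ {ε R} → 0ℚ ℚ.< ε → 0ℚ ℚ.< R → ∃ λ δ → 0ℚ ℚ.< δ × R ℚ.* δ ≡ ε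
  divide {ε} {R} 0<ε 0<R = ε ℚ.* R⁻¹
    , subst (ℚ._< ε ℚ.* R⁻¹) (ℚ.*-zeroˡ R⁻¹)
        (ℚ.*-monoˡ-<-pos R⁻¹ ⦃ ℚ.1/pos⇒pos R ⦃ ℚ.positive 0<R ⦄ ⦄ 0<ε)
    , trans (ℚ.*-comm R (ε ℚ.* R⁻¹)) (trans (ℚ.*-assoc ε R⁻¹ R)
        (trans (cong (ε ℚ.*_) (ℚ.*-inverseˡ R ⦃ R≢0 ⦄)) (ℚ.*-identityʳ ε)))
    where
    R≢0 : ℚ.NonZero R
    R≢0 = ℚ.pos⇒nonZero R ⦃ ℚ.positive 0<R ⦄
    R⁻¹ : ℚ
    R⁻¹ = (ℚ.1/ R) ⦃ R≢0 ⦄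

  *-open : ∀ r u t → 0ℚ ℚ.≤ r → r ℚ.* u ℚ.< t → ∃ λ v → u ℚ.< v × r ℚ.* v ℚ.< t
  *-open r u t 0≤r ru<t = step (divide {t ℚ.- r ℚ.* u} {r ℚ.+ 1ℚ} 0<ε 0<R)
    where
    0<ε : 0ℚ ℚ.< t ℚ.- r ℚ.* u
    0<ε = subst (ℚ._< t ℚ.- r ℚ.* u) (ℚ.+-inverseʳ (r ℚ.* u))
            (ℚ.+-monoˡ-< (ℚ.- (r ℚ.* u)) ru<t)
    0<R : 0ℚ ℚ.< r ℚ.+ 1ℚ
    0<R = ℚ.≤-<-trans 0≤r (p<p+1 r)
    step : (∃ λ δ → 0ℚ ℚ.< δ × (r ℚ.+ 1ℚ) ℚ.* δ ≡ t ℚ.- r ℚ.* u) →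
           ∃ λ v → u ℚ.< v × r ℚ.* v ℚ.< t
    step (δ , 0<δ , Rδ≡ε) = u ℚ.+ δ
      , subst (ℚ._< u ℚ.+ δ) (ℚ.+-identityʳ u) (ℚ.+-monoʳ-< u 0<δ)
      , subst₂ ℚ._<_ (sym (ℚ.*-distribˡ-+ r u δ)) (p+[q-p]≡q (r ℚ.* u) t)
          (ℚ.+-monoʳ-< (r ℚ.* u)
            (subst (r ℚ.* δ ℚ.<_) Rδ≡ε
              (ℚ.*-monoˡ-<-pos δ ⦃ ℚ.positive 0<δ ⦄ (p<p+1 r))))

  *-^-mono-< : ∀ {v w u t} n → 0ℚ ℚ.≤ v → v ℚ.≤ w → v ^ n ℚ.≤ u → u ℚ.* w ℚ.< t →
               v ^ suc n ℚ.< t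
  *-^-mono-< {v} {w} {u} {t} n 0≤v v≤w v^n≤u uw<t = ℚ.≤-<-trans
    (*-mono-≤₀ {v} {w} {v ^ n} {u} (ℚ.≤-trans 0≤v v≤w) (0≤^ 0≤v n) v≤w v^n≤u)
    (subst (ℚ._< t) (ℚ.*-comm u w) uw<t)

  ^-open : ∀ n r t → 0ℚ ℚ.≤ r → r ^ n ℚ.< t → ∃ λ v → r ℚ.< v × v ^ n ℚ.< t
  ^-open zero    r t 0≤r r^n<t = r ℚ.+ 1ℚ , p<p+1 r , r^n<t
  ^-open (suc n) r t 0≤r r^n<t = step₁ (*-open r (r ^ n) t 0≤r r^n<t)
    where
    Goal : Set
    Goal = ∃ λ v → r ℚ.< v × v ^ suc n ℚ.< t

    step₂ : ∀ u → (∃ λ v → r ℚ.< v × u ℚ.* v ℚ.< t) → (∃ λ w → r ℚ.< w × w ^ n ℚ.< u) → Goal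
    step₂ u (v , r<v , uv<t) (w , r<w , w^n<u) = choose (ℚ.≤-total v w)
      where
      0≤v : 0ℚ ℚ.≤ v
      0≤v = ℚ.≤-trans 0≤r (ℚ.<⇒≤ r<v)
      0≤w : 0ℚ ℚ.≤ w
      0≤w = ℚ.≤-trans 0≤r (ℚ.<⇒≤ r<w)
      choose : v ℚ.≤ w ⊎ w ℚ.≤ v → Goal
      choose (inj₁ v≤w) = v , r<v , *-^-mono-< n 0≤v ℚ.≤-refl
        (ℚ.≤-trans (^-mono 0≤v v≤w n) (ℚ.<⇒≤ w^n<u)) uv<t
      choose (inj₂ w≤v) = w , r<w , *-^-mono-< n 0≤w w≤v (ℚ.<⇒≤ w^n<u) uv<t

    step₁ : (∃ λ u → r ^ n ℚ.< u × r ℚ.* u ℚ.< t) → Goal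
    step₁ (u , r^n<u , ru<t) = step₂ u
      (*-open u r t (ℚ.≤-trans (0≤^ 0≤r n) (ℚ.<⇒≤ r^n<u)) (subst (ℚ._< t) (ℚ.*-comm r u) ru<t))
      (^-open n r u 0≤r r^n<u)

open Power-lemmas

-- 2^x is the supremum of the numbers 2^(a/d) over the rationals a/d < x, and
-- r < 2^(a/d)  iff  (max r 0)^d < 2^a.
exp₂ : ℝ → ℝ
below (exp₂ x) r = ∃ λ q → below x q × (r ℚ.⊔ 0ℚ) ^ (↧ₙ q) ℚ.< 2^ℤ (↥ q)
inhabited (exp₂ x) =
  let q , q∈ = inhabited x
  in 0ℚ , q , q∈ , subst (ℚ._< 2^ℤ (↥ q)) (sym (ℚ.*-zeroˡ (0ℚ ^ ℚ.denominator-1 q))) (0<2^ℤ (↥ q))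
bounded (exp₂ x) = 2ℚ ^ N , λ { (q , q∈ , lt) → ℚ.<-irrefl refl (ℚ.<-≤-trans
    (subst (ℚ._< 2^ℤ (↥ q)) (pow q) lt)
    (2^ℤ≤ (num≤ (below⇒< x q∈ (proj₂ (bounded x)))))) }
  where
  N : ℕ
  N = ℤ.∣ ↥ proj₁ (bounded x) ∣
  pow : ∀ q → (2ℚ ^ N ℚ.⊔ 0ℚ) ^ (↧ₙ q) ≡ 2ℚ ^ (N ℕ.* ↧ₙ q)
  pow q = trans (cong (_^ (↧ₙ q)) (ℚ.p≥q⇒p⊔q≡p (0≤^ 0≤2 N))) (^-assocʳ 2ℚ N (↧ₙ q))
down (exp₂ x) {r} {s} r≤s (q , q∈ , lt) =
  q , q∈ , ℚ.≤-<-trans (^-mono (ℚ.p≤q⊔p r 0ℚ) (ℚ.⊔-monoˡ-≤ 0ℚ r≤s) (↧ₙ q)) lt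
open′ (exp₂ x) {r} (q , q∈ , lt) =
  let v , <v , lt′ = ^-open (↧ₙ q) (r ℚ.⊔ 0ℚ) (2^ℤ (↥ q)) (ℚ.p≤q⊔p r 0ℚ) lt
      0≤v = ℚ.≤-trans (ℚ.p≤q⊔p r 0ℚ) (ℚ.<⇒≤ <v)
  in v , ℚ.≤-<-trans (ℚ.p≤p⊔q r 0ℚ) <v , q , q∈
     , subst (λ z → z ^ (↧ₙ q) ℚ.< 2^ℤ (↥ q)) (sym (ℚ.p≥q⇒p⊔q≡p 0≤v)) lt′

NonNegative : (ℕ → ℝ) → Set
NonNegative f = ∀ n → 0ℝ ≤ f n

Nondecreasing : (ℕ → ℝ) → Set
Nondecreasing f = ∀ m n → m ℕ.≤ n → f m ≤ f n

Unbounded : (ℕ → ℝ) → Set₁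
Unbounded f = ∀ B → ∃ λ n → B < f n

TendsTo∞ : (ℕ → ℝ) → Set₁
TendsTo∞ a = ∀ B → ∃ λ N → ∀ n → N ℕ.≤ n → B ≤ a n

partialSum : (ℕ → ℝ) → ℕ → ℝ
partialSum a zero    = 0ℝ
partialSum a (suc n) = partialSum a n + a n

-- Intended for series with nonnegative terms.
Σ[_]<∞ : (ℕ → ℝ) → Set₁
Σ[ a ]<∞ = ∃ λ B → ∀ n → partialSum a n ≤ B

Recursiveℚ : (ℕ → ℕ → ℚ) → Set
Recursiveℚ q = ∃ λ a → ∃ λ b → ∃ λ d →
  Recursive₂ a × Recursive₂ b × Recursive₂ d ×
  (∀ n k → q n k ≡ (a n k ℤ.⊖ b n k) ℚ./ suc (d n k))

-- The values f n are uniformly computable reals:  |f n - q n k| ≤ 2^(-k)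
-- for some recursive q.
Computable : (ℕ → ℝ) → Set
Computable f = ∃ λ q → Recursiveℚ q ×
  (∀ n k → fromℚ (q n k ℚ.- ½ ^ k) ≤ f n × f n ≤ fromℚ (q n k ℚ.+ ½ ^ k))

record IsOrderFunction (f : ℕ → ℝ) : Set₁ where
  field
    computable    : Computable f
    nondecreasing : Nondecreasing f
    unbounded     : Unbounded f

SubIdentical : (ℕ → ℝ) → Set₁
SubIdentical f = NonNegative f × TendsTo∞ (λ n → fromℕ n - f n)

-- Excluded middle decides the comparisons of reals.
inv-least : ExcludedMiddle 0ℓ → (f : ℕ → ℝ) → Unbounded f →
            (x : ℝ) → ∃ (IsLeast (λ m → x ≤ f m))
inv-least em f unb x with m , q , q∈ , q∉ ← unb x =
  least em (λ k → x ≤ f k) (m , λ p p∈ → down (f m) (ℚ.<⇒≤ (below⇒< x p∈ q∉)) q∈)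

inv : ExcludedMiddle 0ℓ → (f : ℕ → ℝ) → Unbounded f → ℝ → ℕ
inv em f unb x = proj₁ (inv-least em f unb x)

Str : Set
Str = List Bool

bit : Bool → ℕ
bit false = 0
bit true  = 1

-- Bijective base 2 notation, least significant digit first; a bijection
-- between Str and ℕ.
⌜_⌝ : Str → ℕ
⌜ [] ⌝    = 0
⌜ b ∷ σ ⌝ = suc (bit b ℕ.+ 2 ℕ.* ⌜ σ ⌝)

⟦_⟧ : Code ⊥ 1 → Str ⇀ Str
⟦ M ⟧ τ σ = φ M ⌜ τ ⌝ ⌜ σ ⌝

PrefixFree : Code ⊥ 1 → Set
PrefixFree M = ∀ τ τ′ → ∃ (⟦ M ⟧ τ) → ∃ (⟦ M ⟧ τ′) → Prefix _≡_ τ τ′ → τ ≡ τ′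

Universal : Code ⊥ 1 → Set
Universal U = PrefixFree U ×
  (∀ M → PrefixFree M → ∃ λ ρ → ∀ τ → ⟦ U ⟧ (ρ ++ τ) ≃ ⟦ M ⟧ τ)

-- K U σ k  means  K(σ) = k; for universal U every σ has such a k.
K : Code ⊥ 1 → Str ⇀ ℕ
K U σ = IsLeast (λ k → ∃ λ τ → ⟦ U ⟧ τ σ × length τ ≡ k)

infix 9 _↾_
_↾_ : (ℕ → Bool) → ℕ → Str
X ↾ n = applyUpTo X n

COMPLEX : Code ⊥ 1 → (ℕ → ℝ) → Pred (ℕ → Bool) 0ℓ
COMPLEX U f X = ∃ λ c → ∀ n → ∃ λ k → K U (X ↾ n) k × f n - fromℕ c ≤ fromℕ k

-- Cantor space is identified with { Y ∈ Baire space | Y n ∈ {0,1} for all n }.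
asBaire : Pred (ℕ → Bool) 0ℓ → Pred (ℕ → ℕ) 0ℓ
asBaire P Y = ∃ λ X → X ∈ P × (∀ n → Y n ≡ bit (X n))

LinearlyUniversal : Code ⊥ 1 → Set
LinearlyUniversal ψ = ∀ θ → ∃ λ a → ∃ λ b → ∀ x → φ ψ (a ℕ.* x ℕ.+ b) ≃ φ θ x

LUA : (ℕ → ℝ) → Pred (ℕ → ℕ) 0ℓ
LUA p X = (∀ n → fromℕ (X n) < p n) ×
  ∃ λ ψ → LinearlyUniversal ψ × ¬ (∃ λ n → φ ψ n (X n))

module Submission where

-- Let ψ be a partial recursive function with ψ(2^e (2x + 1)) = U(ρ 0^x 1), where e = ⌜ ρ ⌝.  Since
-- U simulates every prefix-free machine, ψ is linearly universal, and so is its restriction to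
-- the arguments n ≥ N, because the simulation may start at x = N.  The Kraft inequality for ĥ
-- gives a prefix-free machine computing ψ n from a word of length ĥ n + O(1), so that
-- K(ψ n) ≤ ĥ n + O(1).  Round f, h and ĥ to recursive integer functions, and let m n ≤ f^inv(h n)
-- be the least m at which the rounded f is about h n.  From X the functional computes the code
-- of X ↾ m n, which is less than 2^(m n + 1).  For X in COMPLEX(f),
-- K(X ↾ m n) ≥ f (m n) - O(1) ≥ h n - O(1), so X ↾ m n ≠ ψ n for all sufficiently large n.

open import Defs
open import Level using (0ℓ)
open import Axiom.ExcludedMiddle using (ExcludedMiddle)
open import Data.Empty using (⊥)
open import Data.Nat.Base as ℕ using (ℕ; zero; suc; pred; _∸_; z≤n; s≤s; ⌊_/2⌋; ⌈_/2⌉)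
import Data.Nat.Properties as ℕ
open import Algebra.Bundles using (CommutativeRing)
open import Data.Bool.Base using (Bool; true; false)
open import Data.Fin.Base using (Fin)
open import Data.Fin.Patterns using (0F; 1F; 2F)
open import Data.Integer.Base as ℤ using (+_; -[1+_])
import Data.Integer.Properties as ℤ
open import Data.List.Base using ([]; _∷_; _++_; length; replicate)
import Data.List.Properties as List
open import Data.List.Relation.Binary.Prefix.Heterogeneous using (Prefix; []; _∷_)
open import Data.List.Relation.Binary.Prefix.Heterogeneous.Properties using (fromPointwise)
import Data.List.Relation.Binary.Pointwise as Pointwise
open import Data.Nat.Coprimality using (Coprime)
open import Data.Nat.Divisibility using (_∣_; ∣m+n∣m⇒∣n; ∣n⇒∣m*n; ∣1⇒≡1)
open import Data.Nat.Solver using (module +-*-Solver)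
open +-*-Solver using (solve; _:+_; _:*_; _:=_; con)
open import Data.Product.Base using (∃; _×_; _,_; proj₁; proj₂; map₂)
open import Data.Rational.Base as ℚ using (ℚ; 0ℚ; 1ℚ; ½)
import Data.Rational.Properties as ℚ
open import Data.Rational.Unnormalised.Base as ℚᵘ using (mkℚᵘ)
import Data.Rational.Unnormalised.Properties as ℚᵘ
open import Algebra.Definitions.RawSemiring ℚ.+-*-rawSemiring using (_^_)
open import Algebra.Properties.Semiring.Exp
  (CommutativeRing.semiring ℚ.+-*-commutativeRing) using (^-homo-*)
open import Data.Sum.Base using (_⊎_; inj₁; inj₂)
open import Data.Unit.Base using (⊤; tt)
open import Data.Vec.Base using (Vec; []; _∷_; lookup)
open import Data.Vec.Relation.Binary.Pointwise.Inductive using (Pointwise; []; _∷_)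
open import Function.Base using (_∘_; id)
open import Function.Bundles using (_⇔_; mk⇔; Equivalence)
import Function.Properties.Equivalence as ⇔
open import Relation.Binary.Definitions using (tri<; tri≈; tri>)
open import Relation.Binary.PropositionalEquality
  using (_≡_; _≢_; refl; sym; trans; cong; cong₂; subst; subst₂; module ≡-Reasoning)
open import Relation.Nullary using (¬_; yes; no; contradiction)
open import Relation.Unary using (_∈_)
open ℝ
open Cut-lemmas
open Power-lemmas

-- Kleene codes

mutual
  ⇓-deterministic : ∀ {I Φ n} {e : Code I n} {xs y z} → Φ ⊢ e · xs ⇓ y → Φ ⊢ e · xs ⇓ z → y ≡ z
  ⇓-deterministic ⇓zer ⇓zer = refl
  ⇓-deterministic ⇓suc ⇓suc = refl
  ⇓-deterministic ⇓proj ⇓proj = refl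
  ⇓-deterministic ⇓oracle ⇓oracle = refl
  ⇓-deterministic (⇓comp ds d) (⇓comp ds′ d′) with refl ← ⇓*-deterministic ds ds′ =
    ⇓-deterministic d d′
  ⇓-deterministic (⇓prec₀ d) (⇓prec₀ d′) = ⇓-deterministic d d′
  ⇓-deterministic (⇓precₛ d₁ d₂) (⇓precₛ d₁′ d₂′) with refl ← ⇓-deterministic d₁ d₁′ =
    ⇓-deterministic d₂ d₂′
  ⇓-deterministic {y = m} {z = m′} (⇓μ d below) (⇓μ d′ below′) with ℕ.<-cmp m m′
  ... | tri≈ _ m≡m′ _ = m≡m′
  -- The smaller of two distinct results would be a zero of the searched function and also a point
  -- where its value is a successor.
  ... | tri< m<m′ _ _ with () ← ⇓-deterministic d (proj₂ (below′ m m<m′))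
  ... | tri> _ _ m′<m with () ← ⇓-deterministic (proj₂ (below m′ m′<m)) d′

  ⇓*-deterministic : ∀ {I Φ m n} {gs : Vec (Code I n) m} {xs ys zs} →
    Pointwise (λ g y → Φ ⊢ g · xs ⇓ y) gs ys → Pointwise (λ g y → Φ ⊢ g · xs ⇓ y) gs zs → ys ≡ zs
  ⇓*-deterministic [] [] = refl
  ⇓*-deterministic (d ∷ ds) (d′ ∷ ds′) = cong₂ _∷_ (⇓-deterministic d d′) (⇓*-deterministic ds ds′)

mutual
  -- Lets a functional with an oracle call recursive functions as subroutines.
  relativize : ∀ {I n} → Code ⊥ n → Code I n
  relativize zer         = zer
  relativize suc         = suc
  relativize (proj i)    = proj i
  relativize (comp f gs) = comp (relativize f) (relativize* gs)
  relativize (prec f g)  = prec (relativize f) (relativize g)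
  relativize (μ f)       = μ (relativize f)

  relativize* : ∀ {I m n} → Vec (Code ⊥ n) m → Vec (Code I n) m
  relativize* []       = []
  relativize* (g ∷ gs) = relativize g ∷ relativize* gs

mutual
  relativize-⇓ : ∀ {I Φ n} {e : Code ⊥ n} {xs y} →
    noOracle ⊢ e · xs ⇓ y → Φ ⊢ relativize {I} e · xs ⇓ y
  relativize-⇓ ⇓zer = ⇓zer
  relativize-⇓ ⇓suc = ⇓suc
  relativize-⇓ ⇓proj = ⇓proj
  relativize-⇓ (⇓comp ds d) = ⇓comp (relativize*-⇓ ds) (relativize-⇓ d)
  relativize-⇓ (⇓prec₀ d) = ⇓prec₀ (relativize-⇓ d)
  relativize-⇓ (⇓precₛ d₁ d₂) = ⇓precₛ (relativize-⇓ d₁) (relativize-⇓ d₂)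
  relativize-⇓ (⇓μ d below) =
    ⇓μ (relativize-⇓ d) λ k k<m → proj₁ (below k k<m) , relativize-⇓ (proj₂ (below k k<m))

  relativize*-⇓ : ∀ {I Φ m n} {gs : Vec (Code ⊥ n) m} {xs ys} →
    Pointwise (λ g y → noOracle ⊢ g · xs ⇓ y) gs ys →
    Pointwise (λ g y → Φ ⊢ g · xs ⇓ y) (relativize* {I} gs) ys
  relativize*-⇓ [] = []
  relativize*-⇓ (d ∷ ds) = relativize-⇓ d ∷ relativize*-⇓ ds

comp-⇔ : ∀ {f g : Code ⊥ 1} {x t} → φ g x t → ∀ y → φ (comp f (g ∷ [])) x y ⇔ φ f t y
comp-⇔ g↓t y = mk⇔
  (λ { (⇓comp (d ∷ []) d′) → subst (λ s → φ _ s y) (⇓-deterministic d g↓t) d′ })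
  (λ d → ⇓comp (g↓t ∷ []) d)

-- Composites are assembled in this form from `var`, `app₁`, `app₂` and `const`. The passage back to
-- curried functions is immediate because `lookup` computes on explicit vectors.
Recursive : (n : ℕ) → (Vec ℕ n → ℕ) → Set
Recursive n F = ∃ λ (e : Code ⊥ n) → ∀ xs → noOracle ⊢ e · xs ⇓ F xs

Recursive₁ : (ℕ → ℕ) → Set
Recursive₁ g = ∃ λ (e : Code ⊥ 1) → ∀ x → φ e x (g x)

Recursive₃ : (ℕ → ℕ → ℕ → ℕ) → Set
Recursive₃ g = ∃ λ (e : Code ⊥ 3) → ∀ x y z → noOracle ⊢ e · x ∷ y ∷ z ∷ [] ⇓ g x y z

uncurry₁ : ∀ (g : ℕ → ℕ) → Recursive 1 (λ xs → g (lookup xs 0F)) → Recursive₁ g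
uncurry₁ _ (e , e↓) = e , λ x → e↓ (x ∷ [])

uncurry₂ : ∀ g → Recursive 2 (λ xs → g (lookup xs 0F) (lookup xs 1F)) → Recursive₂ g
uncurry₂ _ (e , e↓) = e , λ x y → e↓ (x ∷ y ∷ [])

uncurry₃ : ∀ g → Recursive 3 (λ xs → g (lookup xs 0F) (lookup xs 1F) (lookup xs 2F)) → Recursive₃ g
uncurry₃ _ (e , e↓) = e , λ x y z → e↓ (x ∷ y ∷ z ∷ [])

module _ {n : ℕ} where
  var : (i : Fin n) → Recursive n (λ xs → lookup xs i)
  var i = proj i , λ _ → ⇓proj

  app₁ : ∀ {g F} → Recursive₁ g → Recursive n F → Recursive n (λ xs → g (F xs))
  app₁ (e , e↓) (a , a↓) = comp e (a ∷ []) , λ xs → ⇓comp (a↓ xs ∷ []) (e↓ _)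

  app₂ : ∀ {g F G} → Recursive₂ g → Recursive n F → Recursive n G →
    Recursive n (λ xs → g (F xs) (G xs))
  app₂ (e , e↓) (a , a↓) (b , b↓) =
    comp e (a ∷ b ∷ []) , λ xs → ⇓comp (a↓ xs ∷ b↓ xs ∷ []) (e↓ _ _)

  const : ∀ k → Recursive n (λ _ → k)
  const zero    = zer , λ _ → ⇓zer
  const (suc k) with e , e↓ ← const k = comp suc (e ∷ []) , λ xs → ⇓comp (e↓ xs ∷ []) ⇓suc

-- The recursion equations are propositional, so that g may be any function satisfying them.
primrec₁ : ∀ {g : ℕ → ℕ} {s} → Recursive₂ s → (∀ n → g (suc n) ≡ s n (g n)) → Recursive₁ g
primrec₁ {g} (e , e↓) g-suc = prec (proj₁ z) e , go
  where
  z : Recursive 0 (λ _ → g 0)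
  z = const (g 0)
  go : ∀ n → φ (prec (proj₁ z) e) n (g n)
  go zero    = ⇓prec₀ (proj₂ z [])
  go (suc n) = subst (φ _ _) (sym (g-suc n)) (⇓precₛ (go n) (e↓ n (g n)))

primrec₂ : ∀ {g : ℕ → ℕ → ℕ} {z s} → Recursive₁ z → Recursive₃ s →
  (∀ x → g 0 x ≡ z x) → (∀ n x → g (suc n) x ≡ s n (g n x) x) → Recursive₂ g
primrec₂ {g} (z , z↓) (e , e↓) g-zero g-suc = prec z e , go
  where
  go : ∀ n x → noOracle ⊢ prec z e · n ∷ x ∷ [] ⇓ g n x
  go zero    x = subst (noOracle ⊢ prec z e · _ ⇓_) (sym (g-zero x)) (⇓prec₀ (z↓ x))
  go (suc n) x = subst (noOracle ⊢ prec z e · _ ⇓_) (sym (g-suc n x))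
    (⇓precₛ (go n x) (e↓ n (g n x) x))

-- Elementary recursive functions

suc-recursive : Recursive₁ suc
suc-recursive = suc , λ _ → ⇓suc

pred-recursive : Recursive₁ pred
pred-recursive = primrec₁ (uncurry₂ (λ n _ → n) (var 0F)) (λ _ → refl)

+-recursive : Recursive₂ ℕ._+_
+-recursive = primrec₂ (uncurry₁ id (var 0F))
  (uncurry₃ (λ _ y _ → suc y) (app₁ suc-recursive (var 1F)))
  (λ _ → refl) (λ _ _ → refl)

*-recursive : Recursive₂ ℕ._*_
*-recursive = primrec₂ (uncurry₁ (λ _ → 0) (const 0))
  (uncurry₃ (λ _ y x → x ℕ.+ y) (app₂ +-recursive (var 2F) (var 1F)))
  (λ _ → refl) (λ _ _ → refl)

∸-recursive : Recursive₂ _∸_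
∸-recursive = uncurry₂ _∸_ (app₂ flipped (var 1F) (var 0F))
  where
  flipped : Recursive₂ (λ n m → m ∸ n)
  flipped = primrec₂ (uncurry₁ id (var 0F))
    (uncurry₃ (λ _ y _ → pred y) (app₁ pred-recursive (var 1F)))
    (λ _ → refl) (λ n m → sym (ℕ.pred[m∸n]≡m∸[1+n] m n))

2^-recursive : Recursive₁ (2 ℕ.^_)
2^-recursive = primrec₁
  (uncurry₂ (λ _ y → 2 ℕ.* y) (app₂ *-recursive (const 2) (var 1F))) (λ _ → refl)

⌊/2⌋-recursive : Recursive₁ ⌊_/2⌋
⌊/2⌋-recursive = primrec₁ (uncurry₂ _∸_ (app₂ ∸-recursive (var 0F) (var 1F)))
  -- `⌊ suc n /2⌋` is `⌈ n /2⌉` by definition, and this is `n` minus `⌊ n /2⌋`.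
  (λ n → sym (trans (cong (_∸ ⌊ n /2⌋) (sym (ℕ.⌊n/2⌋+⌈n/2⌉≡n n))) (ℕ.m+n∸m≡n ⌊ n /2⌋ ⌈ n /2⌉)))

parity : ℕ → ℕ
parity n = n ∸ 2 ℕ.* ⌊ n /2⌋

parity-recursive : Recursive₁ parity
parity-recursive = uncurry₁ parity
  (app₂ ∸-recursive (var 0F) (app₂ *-recursive (const 2) (app₁ ⌊/2⌋-recursive (var 0F))))

infixl 8 _≫_
_≫_ : ℕ → ℕ → ℕ
n ≫ zero  = n
n ≫ suc k = ⌊ n ≫ k /2⌋

≫-recursive : Recursive₂ _≫_
≫-recursive = uncurry₂ _≫_ (app₂ flipped (var 1F) (var 0F))
  where
  flipped : Recursive₂ (λ k n → n ≫ k)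
  flipped = primrec₂ (uncurry₁ id (var 0F))
    (uncurry₃ (λ _ y _ → ⌊ y /2⌋) (app₁ ⌊/2⌋-recursive (var 1F)))
    (λ _ → refl) (λ _ _ → refl)

distance-recursive : Recursive₂ (λ m n → (m ∸ n) ℕ.+ (n ∸ m))
distance-recursive = uncurry₂ _ (app₂ +-recursive
  (app₂ ∸-recursive (var 0F) (var 1F)) (app₂ ∸-recursive (var 1F) (var 0F)))

-- Unbounded search and partial inverses

IsFirstZero : (ℕ → ℕ) → ℕ → Set
IsFirstZero g m = g m ≡ 0 × (∀ k → k ℕ.< m → g k ≢ 0)

firstZero : ∀ (g : ℕ → ℕ) → ∀ m → g m ≡ 0 → ∃ (IsFirstZero g)
firstZero g zero g0 = zero , g0 , λ _ ()
firstZero g (suc m) gm with g 0 ℕ.≟ 0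
... | yes g0 = zero , g0 , λ _ ()
... | no g0≢ with k , gk , below ← firstZero (g ∘ suc) m gm =
  suc k , gk , λ { zero _ → g0≢ ; (suc j) (s≤s j<k) → below j j<k }

-- Stated for a single parameter `n`, so that it also serves searches that diverge at other
-- parameters.
search : ∀ {g : ℕ → ℕ → ℕ} (g-rec : Recursive₂ g) {n m} →
  IsFirstZero (λ k → g k n) m → φ (μ (proj₁ g-rec)) n m
search {g} (e , e↓) {n} {m} (gm≡0 , below) =
  ⇓μ (subst (noOracle ⊢ e · _ ⇓_) gm≡0 (e↓ m n)) λ k k<m →
  pred (g k n) , subst (noOracle ⊢ e · _ ⇓_) (suc-pred′ (below k k<m)) (e↓ k n)
  where
  suc-pred′ : ∀ {k} → k ≢ 0 → k ≡ suc (pred k)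
  suc-pred′ {zero}  k≢0 = contradiction refl k≢0
  suc-pred′ {suc k} _   = refl

abstract
  minimize : ∀ {g : ℕ → ℕ → ℕ} → Recursive₂ g → (∀ n → ∃ λ m → g m n ≡ 0) →
    ∃ λ f → Recursive₁ f × (∀ n → IsFirstZero (λ k → g k n) (f n))
  minimize {g} g-rec zeros =
    proj₁ ∘ least′ , (_ , λ n → search g-rec (proj₂ (least′ n))) , proj₂ ∘ least′
    where
    least′ : ∀ n → ∃ (IsFirstZero (λ k → g k n))
    least′ n = firstZero (λ k → g k n) (proj₁ (zeros n)) (proj₂ (zeros n))

IsFirstZero-≤ : ∀ {g m} → IsFirstZero g m → ∀ {k} → g k ≡ 0 → m ℕ.≤ k
IsFirstZero-≤ (_ , below) {k} gk≡0 = ℕ.≮⇒≥ (λ k<m → below k k<m gk≡0)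

-- Search for an `x` with |c x - n| = 0. The search halts only on the range of `c`, and injectivity
-- ensures that no smaller zero is found first.
partial-inverse : ∀ {c} → Recursive₁ c → (∀ {x y} → c x ≡ c y → x ≡ y) →
  ∃ λ e → ∀ n x → φ e n x ⇔ (n ≡ c x)
partial-inverse {c} c-rec c-inj = μ (proj₁ code) , λ n x → mk⇔ to (from n x)
  where
  d : ℕ → ℕ → ℕ
  d x n = (c x ∸ n) ℕ.+ (n ∸ c x)
  code : Recursive₂ d
  code = uncurry₂ d (app₂ distance-recursive (app₁ c-rec (var 0F)) (var 1F))
  d≡0 : ∀ x n → d x n ≡ 0 → n ≡ c x
  d≡0 x n eq = ℕ.≤-antisym (ℕ.m∸n≡0⇒m≤n (ℕ.m+n≡0⇒n≡0 (c x ∸ n) eq))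
    (ℕ.m∸n≡0⇒m≤n (ℕ.m+n≡0⇒m≡0 (c x ∸ n) eq))
  to : ∀ {n x} → φ (μ (proj₁ code)) n x → n ≡ c x
  to (⇓μ cx↓0 _) = d≡0 _ _ (⇓-deterministic (proj₂ code _ _) cx↓0)
  from : ∀ n x → n ≡ c x → φ (μ (proj₁ code)) n x
  from _ x refl = search code
    (cong₂ ℕ._+_ (ℕ.n∸n≡0 (c x)) (ℕ.n∸n≡0 (c x)) ,
     λ k k<x d≡0′ → ℕ.<⇒≢ k<x (sym (c-inj (d≡0 k (c x) d≡0′))))

-- Transports `θ` to the range of `c` and leaves it undefined elsewhere. With `c` a family of code
-- words this yields a machine whose domain consists of code words; with `c` a shift by `N` it
-- restricts a function to arguments from `N` on.
along-injection : ∀ {c} → Recursive₁ c → (∀ {x y} → c x ≡ c y → x ≡ y) → (θ : Code ⊥ 1) →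
  ∃ λ e → ∀ n y → φ e n y ⇔ (∃ λ x → n ≡ c x × φ θ x y)
along-injection c-rec c-inj θ with i , inverts ← partial-inverse c-rec c-inj =
  comp θ (i ∷ []) , λ n y → mk⇔
    (λ { (⇓comp (d ∷ []) d′) → _ , Equivalence.to (inverts _ _) d , d′ })
    (λ { (x , n≡cx , d) → ⇓comp (Equivalence.from (inverts _ _) n≡cx ∷ []) d })

-- Strings and a linearly universal function

⌊2*n/2⌋≡n : ∀ n → ⌊ 2 ℕ.* n /2⌋ ≡ n
⌊2*n/2⌋≡n zero    = refl
⌊2*n/2⌋≡n (suc n) = trans (cong ⌊_/2⌋ (ℕ.*-suc 2 n)) (cong suc (⌊2*n/2⌋≡n n))

⌊1+2*n/2⌋≡n : ∀ n → ⌊ suc (2 ℕ.* n) /2⌋ ≡ n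
⌊1+2*n/2⌋≡n zero    = refl
⌊1+2*n/2⌋≡n (suc n) = trans (cong (⌊_/2⌋ ∘ suc) (ℕ.*-suc 2 n)) (cong suc (⌊1+2*n/2⌋≡n n))

⌜⌝-injective : ∀ σ τ → ⌜ σ ⌝ ≡ ⌜ τ ⌝ → σ ≡ τ
⌜⌝-injective [] [] _ = refl
⌜⌝-injective (false ∷ σ) (false ∷ τ) eq =
  cong (false ∷_) (⌜⌝-injective σ τ (ℕ.*-cancelˡ-≡ _ _ 2 (ℕ.suc-injective eq)))
⌜⌝-injective (true ∷ σ) (true ∷ τ) eq =
  cong (true ∷_) (⌜⌝-injective σ τ (ℕ.*-cancelˡ-≡ _ _ 2 (ℕ.suc-injective (ℕ.suc-injective eq))))
⌜⌝-injective (false ∷ σ) (true ∷ τ) eq =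
  contradiction (ℕ.suc-injective eq) (ℕ.even≢odd ⌜ σ ⌝ ⌜ τ ⌝)
⌜⌝-injective (true ∷ σ) (false ∷ τ) eq =
  contradiction (sym (ℕ.suc-injective eq)) (ℕ.even≢odd ⌜ τ ⌝ ⌜ σ ⌝)

⌜⌝-surjective : ∀ n → ∃ λ σ → n ≡ ⌜ σ ⌝
⌜⌝-surjective zero = [] , refl
⌜⌝-surjective (suc n) with σ , refl ← ⌜⌝-surjective n = increment σ , sym (⌜increment⌝ σ)
  where
  -- The digits `false` and `true` stand for 1 and 2: incrementing 1 gives 2, and incrementing 2
  -- gives 1 with a carry.
  increment : Str → Str
  increment []          = false ∷ []
  increment (false ∷ σ) = true ∷ σ
  increment (true ∷ σ)  = false ∷ increment σ
  ⌜increment⌝ : ∀ σ → ⌜ increment σ ⌝ ≡ suc ⌜ σ ⌝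
  ⌜increment⌝ []          = refl
  ⌜increment⌝ (false ∷ σ) = refl
  ⌜increment⌝ (true ∷ σ)  =
    trans (cong (λ n → suc (2 ℕ.* n)) (⌜increment⌝ σ)) (cong suc (ℕ.*-suc 2 ⌜ σ ⌝))

⌜++⌝ : ∀ σ τ → ⌜ σ ++ τ ⌝ ≡ ⌜ σ ⌝ ℕ.+ 2 ℕ.^ length σ ℕ.* ⌜ τ ⌝
⌜++⌝ []      τ = sym (ℕ.*-identityˡ ⌜ τ ⌝)
⌜++⌝ (b ∷ σ) τ = trans (cong (λ n → suc (bit b ℕ.+ 2 ℕ.* n)) (⌜++⌝ σ τ))
  (solve 4 (λ b s p t → con 1 :+ (b :+ con 2 :* (s :+ p :* t)) :=
                        con 1 :+ (b :+ con 2 :* s) :+ con 2 :* p :* t) refl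
    (bit b) ⌜ σ ⌝ (2 ℕ.^ length σ) ⌜ τ ⌝)

-- With the next lemma, codes of words of length l lie between 2^l - 1 and 2^(l+1) - 2. These
-- intervals are disjoint for different l, so the code determines the length.
2^length≤1+⌜⌝ : ∀ σ → 2 ℕ.^ length σ ℕ.≤ suc ⌜ σ ⌝
2^length≤1+⌜⌝ []      = ℕ.≤-refl
2^length≤1+⌜⌝ (b ∷ σ) = begin
  2 ℕ.* 2 ℕ.^ length σ               ≤⟨ ℕ.*-monoʳ-≤ 2 (2^length≤1+⌜⌝ σ) ⟩
  2 ℕ.* suc ⌜ σ ⌝                    ≡⟨ ℕ.*-suc 2 ⌜ σ ⌝ ⟩
  2 ℕ.+ 2 ℕ.* ⌜ σ ⌝                  ≤⟨ ℕ.+-monoʳ-≤ 2 (ℕ.m≤n+m (2 ℕ.* ⌜ σ ⌝) (bit b)) ⟩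
  2 ℕ.+ (bit b ℕ.+ 2 ℕ.* ⌜ σ ⌝)      ∎
  where open ℕ.≤-Reasoning

2+⌜⌝≤2^[1+length] : ∀ σ → 2 ℕ.+ ⌜ σ ⌝ ℕ.≤ 2 ℕ.^ suc (length σ)
2+⌜⌝≤2^[1+length] []      = ℕ.≤-refl
2+⌜⌝≤2^[1+length] (b ∷ σ) = begin
  3 ℕ.+ (bit b ℕ.+ 2 ℕ.* ⌜ σ ⌝)      ≤⟨ ℕ.+-monoʳ-≤ 3 (ℕ.+-monoˡ-≤ (2 ℕ.* ⌜ σ ⌝) (bit≤1 b)) ⟩
  4 ℕ.+ 2 ℕ.* ⌜ σ ⌝                  ≡⟨ ℕ.*-distribˡ-+ 2 2 ⌜ σ ⌝ ⟨
  2 ℕ.* (2 ℕ.+ ⌜ σ ⌝)                ≤⟨ ℕ.*-monoʳ-≤ 2 (2+⌜⌝≤2^[1+length] σ) ⟩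
  2 ℕ.* 2 ℕ.^ suc (length σ)         ∎
  where
  open ℕ.≤-Reasoning
  bit≤1 : ∀ b → bit b ℕ.≤ 1
  bit≤1 false = z≤n
  bit≤1 true  = s≤s z≤n

-- Prefix-free families and simulation by the universal machine

PrefixFreeFamily : (ℕ → Str) → Set
PrefixFreeFamily c = ∀ x y → Prefix _≡_ (c x) (c y) → x ≡ y

unary : ℕ → Str
unary x = replicate x false ++ true ∷ []

unary-prefix-free : PrefixFreeFamily unary
unary-prefix-free zero    zero    _       = refl
unary-prefix-free zero    (suc _) (() ∷ _)
unary-prefix-free (suc _) zero    (() ∷ _)
unary-prefix-free (suc x) (suc y) (_ ∷ p) = cong suc (unary-prefix-free x y p)

⌜unary⌝ : ∀ x → ⌜ unary x ⌝ ≡ 3 ℕ.* 2 ℕ.^ x ∸ 1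
⌜unary⌝ x = cong (_∸ 1) (go x)
  where
  -- The successor of the code is 3 for the word 1, and each leading zero doubles it.
  go : ∀ x → suc ⌜ unary x ⌝ ≡ 3 ℕ.* 2 ℕ.^ x
  go zero    = refl
  go (suc x) = trans (sym (ℕ.*-suc 2 ⌜ unary x ⌝))
    (trans (cong (2 ℕ.*_) (go x))
      (solve 1 (λ p → con 2 :* (con 3 :* p) := con 3 :* (con 2 :* p)) refl (2 ℕ.^ x)))

⌜unary⌝-recursive : Recursive₁ (λ x → ⌜ unary x ⌝)
⌜unary⌝-recursive = map₂ (λ e↓ x → subst (φ _ x) (sym (⌜unary⌝ x)) (e↓ x))
  (uncurry₁ (λ x → 3 ℕ.* 2 ℕ.^ x ∸ 1) (app₂ ∸-recursive
    (app₂ *-recursive (const 3) (app₁ 2^-recursive (var 0F))) (const 1)))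

module _ {c : ℕ → Str} (c-recursive : Recursive₁ (λ x → ⌜ c x ⌝))
  (c-free : PrefixFreeFamily c) where
  private
    c-injective : ∀ {x y} → ⌜ c x ⌝ ≡ ⌜ c y ⌝ → x ≡ y
    c-injective {x} {y} eq =
      c-free x y (subst (Prefix _≡_ (c x)) (⌜⌝-injective _ _ eq)
        (fromPointwise (Pointwise.refl refl)))

  -- The machine that sends the word `c x` to the word coded by `θ x`, and is defined on no other
  -- words, is prefix-free because `c` is. The string `ρ` is its prefix in the universal machine.
  simulate : ∀ {U} → Universal U → (θ : Code ⊥ 1) → ∃ λ ρ → ∀ x → φ U ⌜ ρ ++ c x ⌝ ≃ φ θ x
  simulate {U} (_ , universal) θ
    with M , M-spec ← along-injection c-recursive c-injective θ = ρ , λ x y → go x y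
    where
    open Equivalence
    domain : ∀ {τ σ} → ⟦ M ⟧ τ σ → ∃ λ x → τ ≡ c x
    domain M↓ with x , eq , _ ← to (M-spec _ _) M↓ = x , ⌜⌝-injective _ _ eq
    M-prefix-free : PrefixFree M
    M-prefix-free τ τ′ (_ , M↓) (_ , M↓′) p with domain M↓ | domain M↓′
    ... | x , refl | y , refl = cong c (c-free x y p)
    ρ : Str
    ρ = proj₁ (universal M M-prefix-free)
    M-on-c : ∀ x y → φ M ⌜ c x ⌝ y ⇔ φ θ x y
    M-on-c x y = mk⇔
      (λ M↓ → let x′ , eq , θ↓ = to (M-spec _ _) M↓
              in subst (λ z → φ θ z y) (sym (c-injective eq)) θ↓)
      (λ θ↓ → from (M-spec _ _) (x , refl , θ↓))
    go : ∀ x y → φ U ⌜ ρ ++ c x ⌝ y ⇔ φ θ x y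
    go x y with σ , refl ← ⌜⌝-surjective y =
      ⇔.trans (proj₂ (universal M M-prefix-free) (c x) σ) (M-on-c x ⌜ σ ⌝)

-- Decoding of lengths and pairs

length-search : Recursive₂ (λ l e → (2 ℕ.+ e) ∸ 2 ℕ.^ suc l)
length-search = uncurry₂ _ (app₂ ∸-recursive (app₂ +-recursive (const 2) (var 1F))
  (app₁ 2^-recursive (app₁ suc-recursive (var 0F))))

length-search-zeros : ∀ e → ∃ λ l → (2 ℕ.+ e) ∸ 2 ℕ.^ suc l ≡ 0
length-search-zeros e with σ , refl ← ⌜⌝-surjective e =
  length σ , ℕ.m≤n⇒m∸n≡0 (2+⌜⌝≤2^[1+length] σ)

-- The length is the least l with 2 + e ≤ 2^(l+1), where e is the code: any smaller l contradicts
-- the lower bound 2^|σ| ≤ 1 + e.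
length-recursive : ∃ λ len → Recursive₁ len × (∀ σ → len ⌜ σ ⌝ ≡ length σ)
length-recursive with len , len-rec , first ← minimize length-search length-search-zeros =
  len , len-rec , λ σ → ℕ.≤-antisym
    (IsFirstZero-≤ (first ⌜ σ ⌝) (ℕ.m≤n⇒m∸n≡0 (2+⌜⌝≤2^[1+length] σ)))
    (ℕ.≮⇒≥ λ len<length → ℕ.<⇒≱ (s≤s (2^length≤1+⌜⌝ σ))
      (ℕ.≤-trans (ℕ.m∸n≡0⇒m≤n (proj₁ (first ⌜ σ ⌝))) (ℕ.^-monoʳ-≤ 2 len<length)))

parity-even : ∀ n → parity (2 ℕ.* n) ≡ 0
parity-even n = trans (cong (λ k → 2 ℕ.* n ∸ 2 ℕ.* k) (⌊2*n/2⌋≡n n)) (ℕ.n∸n≡0 (2 ℕ.* n))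

parity-odd : ∀ n → parity (suc (2 ℕ.* n)) ≡ 1
parity-odd n = trans (cong (λ k → suc (2 ℕ.* n) ∸ 2 ℕ.* k) (⌊1+2*n/2⌋≡n n))
  (ℕ.m+n∸n≡m 1 (2 ℕ.* n))

2^*-≫ : ∀ k n → (2 ℕ.^ k ℕ.* n) ≫ k ≡ n
2^*-≫ zero    n = ℕ.*-identityˡ n
2^*-≫ (suc k) n = trans (cong ⌊_/2⌋ (trans (cong (_≫ k)
  (solve 2 (λ p n → con 2 :* p :* n := p :* (con 2 :* n)) refl (2 ℕ.^ k) n)) (2^*-≫ k (2 ℕ.* n))))
  (⌊2*n/2⌋≡n n)

-- For fixed `e` this is affine in `x`, as linear universality requires, and `e` can still be
-- recovered as the exponent of 2.
pair : ℕ → ℕ → ℕ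
pair e x = 2 ℕ.^ e ℕ.* suc (2 ℕ.* x)

fst-search : Recursive₂ (λ e n → 1 ∸ parity (n ≫ e))
fst-search = uncurry₂ _ (app₂ ∸-recursive (const 1)
  (app₁ parity-recursive (app₂ ≫-recursive (var 1F) (var 0F))))

-- Shifting right fewer than `e` times leaves an even number; after `e` shifts the odd factor
-- `suc (2 * x)` remains.
fst-search-first : ∀ e x → IsFirstZero (λ k → 1 ∸ parity (pair e x ≫ k)) e
fst-search-first e x =
    cong (1 ∸_) (trans (cong parity (2^*-≫ e (suc (2 ℕ.* x)))) (parity-odd x))
  , λ k k<e ≡0 → ℕ.1+n≢0 (trans (sym (cong (1 ∸_) (even k k<e))) ≡0)
  where
  even : ∀ k → k ℕ.< e → parity (pair e x ≫ k) ≡ 0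
  even k k<e with j , refl ← ℕ.m≤n⇒∃[o]m+o≡n k<e = trans
    (cong parity (trans (cong (_≫ k) split) (2^*-≫ k _)))
    (parity-even (2 ℕ.^ j ℕ.* suc (2 ℕ.* x)))
    where
    split : pair e x ≡ 2 ℕ.^ k ℕ.* (2 ℕ.* (2 ℕ.^ j ℕ.* suc (2 ℕ.* x)))
    split = trans (cong (λ p → 2 ℕ.* p ℕ.* suc (2 ℕ.* x)) (ℕ.^-distribˡ-+-* 2 k j))
      (solve 3 (λ p q s → con 2 :* (p :* q) :* s := p :* (con 2 :* (q :* s))) refl
        (2 ℕ.^ k) (2 ℕ.^ j) (suc (2 ℕ.* x)))

abstract
  -- The exponent of 2 gives the code e of `ρ`, a shift by e + 1 gives `x`, and `⌜++⌝` assembles the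
  -- code of the concatenation, with the length of `ρ` computed from e.
  decoder : ∃ λ (T : Code ⊥ 1) → ∀ ρ x → φ T (pair ⌜ ρ ⌝ x) ⌜ ρ ++ unary x ⌝
  decoder with len , len-rec , len≡length ← length-recursive = T , T↓
    where
    W : ℕ → ℕ → ℕ
    W e n = e ℕ.+ 2 ℕ.^ len e ℕ.* ⌜ unary (n ≫ suc e) ⌝
    W-recursive : Recursive₂ W
    W-recursive = uncurry₂ W (app₂ +-recursive (var 0F) (app₂ *-recursive
      (app₁ 2^-recursive (app₁ len-rec (var 0F)))
      (app₁ ⌜unary⌝-recursive (app₂ ≫-recursive (var 1F) (app₁ suc-recursive (var 0F))))))
    T : Code ⊥ 1
    T = comp (proj₁ W-recursive) (μ (proj₁ fst-search) ∷ proj 0F ∷ [])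
    W≡ : ∀ ρ x → W ⌜ ρ ⌝ (pair ⌜ ρ ⌝ x) ≡ ⌜ ρ ++ unary x ⌝
    W≡ ρ x = trans
      (cong₂ (λ l m → ⌜ ρ ⌝ ℕ.+ 2 ℕ.^ l ℕ.* ⌜ unary m ⌝) (len≡length ρ)
        (trans (cong ⌊_/2⌋ (2^*-≫ ⌜ ρ ⌝ _)) (⌊1+2*n/2⌋≡n x)))
      (sym (⌜++⌝ ρ (unary x)))
    T↓ : ∀ ρ x → φ T (pair ⌜ ρ ⌝ x) ⌜ ρ ++ unary x ⌝
    T↓ ρ x = subst (φ T _) (W≡ ρ x)
      (⇓comp (search fst-search (fst-search-first ⌜ ρ ⌝ x) ∷ ⇓proj ∷ []) (proj₂ W-recursive _ _))

+N-recursive : ∀ N → Recursive₁ (ℕ._+ N)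
+N-recursive N = uncurry₁ _ (app₂ +-recursive (var 0F) (const N))

unary-shift-recursive : ∀ N → Recursive₁ (λ x → ⌜ unary (x ℕ.+ N) ⌝)
unary-shift-recursive N =
  uncurry₁ _ (app₁ ⌜unary⌝-recursive (app₁ (+N-recursive N) (var 0F)))

unary-shift-prefix-free : ∀ N → PrefixFreeFamily (λ x → unary (x ℕ.+ N))
unary-shift-prefix-free N x y p = ℕ.+-cancelʳ-≡ N x y (unary-prefix-free _ _ p)

module _ {U : Code ⊥ 1} (U-universal : Universal U) where
  open Equivalence

  abstract
    universal-partial : Code ⊥ 1
    universal-partial = comp U (proj₁ decoder ∷ [])

    -- The x-th value of θ is read off at x + N, so that the linear progression starts above N.
    universal-partial-linear : ∀ N θ → ∃ λ a → ∃ λ b → ∀ x →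
      N ℕ.≤ a ℕ.* x ℕ.+ b × (φ universal-partial (a ℕ.* x ℕ.+ b) ≃ φ θ x)
    universal-partial-linear N θ
      with ρ , simulates ← simulate (unary-shift-recursive N) (unary-shift-prefix-free N) U-universal θ =
      2 ℕ.* 2 ℕ.^ ⌜ ρ ⌝ , pair ⌜ ρ ⌝ N , λ x →
        let n≡ = affine (2 ℕ.^ ⌜ ρ ⌝) x in
        subst (N ℕ.≤_) (sym n≡) (N≤pair {⌜ ρ ⌝} x) ,
        λ y → subst (λ n → φ universal-partial n y ⇔ φ θ x y) (sym n≡)
          (⇔.trans (comp-⇔ (proj₂ decoder ρ (x ℕ.+ N)) y) (simulates x y))
      where
      affine : ∀ p x → 2 ℕ.* p ℕ.* x ℕ.+ p ℕ.* suc (2 ℕ.* N) ≡ p ℕ.* suc (2 ℕ.* (x ℕ.+ N))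
      affine p x = solve 3 (λ p x n → con 2 :* p :* x :+ p :* (con 1 :+ con 2 :* n) :=
                                      p :* (con 1 :+ con 2 :* (x :+ n))) refl p x N
      N≤pair : ∀ {e} x → N ℕ.≤ pair e (x ℕ.+ N)
      N≤pair {e} x = ℕ.≤-trans (ℕ.m≤n+m N x) (ℕ.≤-trans (ℕ.m≤m+n _ _) (ℕ.≤-trans (ℕ.n≤1+n _)
        (ℕ.m≤n*m _ (2 ℕ.^ e) ⦃ ℕ.m^n≢0 2 e ⦄)))

  -- The restriction to arguments from `N` on stays linearly universal because the progressions of
  -- `universal-partial-linear` can be chosen inside its domain of restriction. It serves to discard
  -- finitely many exceptional arguments.
  universal-partial-restricted : ∀ N → ∃ λ ψ → LinearlyUniversal ψ ×
    (∀ {n y} → φ ψ n y → N ℕ.≤ n × φ universal-partial n y)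
  universal-partial-restricted N
    with ψ , ψ-spec ← along-injection (+N-recursive N) (ℕ.+-cancelʳ-≡ N _ _)
                        (comp universal-partial (proj₁ (+N-recursive N) ∷ [])) = ψ , linear , sound
    where
    sound : ∀ {n y} → φ ψ n y → N ℕ.≤ n × φ universal-partial n y
    sound ψ↓ with x , refl , θ↓ ← to (ψ-spec _ _) ψ↓ =
      ℕ.m≤n+m N x , to (comp-⇔ (proj₂ (+N-recursive N) x) _) θ↓
    complete : ∀ {n y} → N ℕ.≤ n → φ universal-partial n y → φ ψ n y
    complete {n} {y} N≤n ↓y = from (ψ-spec n y)
      (n ∸ N , sym n∸N+N≡n , from (comp-⇔ (proj₂ (+N-recursive N) (n ∸ N)) y)
        (subst (λ m → φ universal-partial m y) (sym n∸N+N≡n) ↓y))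
      where
      n∸N+N≡n : n ∸ N ℕ.+ N ≡ n
      n∸N+N≡n = ℕ.m∸n+n≡m N≤n
    linear : LinearlyUniversal ψ
    linear θ =
      let a , b , above = universal-partial-linear N θ
      in a , b , λ x y → let N≤n , ≃θ = above x in mk⇔
        (λ ψ↓ → to (≃θ y) (proj₂ (sound ψ↓)))
        (λ θ↓ → complete N≤n (from (≃θ y) θ↓))

-- A prefix code from nondecreasing word lengths

halve : ∀ n → ∃ λ b → n ≡ bit b ℕ.+ 2 ℕ.* ⌊ n /2⌋
halve zero    = false , refl
halve (suc zero) = true , refl
halve (suc (suc n)) with b , eq ← halve n = b , (begin
  2 ℕ.+ n                             ≡⟨ cong (2 ℕ.+_) eq ⟩
  2 ℕ.+ (bit b ℕ.+ 2 ℕ.* ⌊ n /2⌋)     ≡⟨ solve 2 (λ b h → con 2 :+ (b :+ con 2 :* h) :=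
                                                          b :+ con 2 :* (con 1 :+ h)) refl
                                           (bit b) ⌊ n /2⌋ ⟩
  bit b ℕ.+ 2 ℕ.* suc ⌊ n /2⌋         ∎)
  where open ≡-Reasoning

odd? : ℕ → Bool
odd? n = proj₁ (halve n)

bit-odd? : ∀ n → bit (odd? n) ≡ parity n
bit-odd? n = sym (trans
  (cong (_∸ 2 ℕ.* ⌊ n /2⌋) (proj₂ (halve n))) (ℕ.m+n∸n≡m _ (2 ℕ.* ⌊ n /2⌋)))

-- The most significant digit comes first, contrary to ⌜_⌝: this makes the order of numerals
-- compatible with prefixes.
bits : ℕ → ℕ → Str
bits zero    n = []
bits (suc l) n = odd? (n ≫ l) ∷ bits l n

length-bits : ∀ l n → length (bits l n) ≡ l
length-bits zero    n = refl
length-bits (suc l) n = cong suc (length-bits l n)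

bits-recursive : Recursive₂ (λ l n → ⌜ bits l n ⌝)
bits-recursive = primrec₂ (uncurry₁ (λ _ → 0) (const 0))
  (uncurry₃ (λ l y n → suc (parity (n ≫ l) ℕ.+ 2 ℕ.* y))
    (app₁ suc-recursive (app₂ +-recursive
      (app₁ parity-recursive (app₂ ≫-recursive (var 2F) (var 0F)))
      (app₂ *-recursive (const 2) (var 1F)))))
  (λ _ → refl)
  (λ l n → cong (λ b → suc (b ℕ.+ 2 ℕ.* ⌜ bits l n ⌝)) (bit-odd? (n ≫ l)))

value : Str → ℕ
value []      = 0
value (b ∷ σ) = bit b ℕ.* 2 ℕ.^ length σ ℕ.+ value σ

value-++ : ∀ σ τ → value (σ ++ τ) ≡ value σ ℕ.* 2 ℕ.^ length τ ℕ.+ value τ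
value-++ []      τ = refl
value-++ (b ∷ σ) τ = begin
  bit b ℕ.* 2 ℕ.^ length (σ ++ τ) ℕ.+ value (σ ++ τ)
    ≡⟨ cong₂ (λ p v → bit b ℕ.* p ℕ.+ v)
         (trans (cong (2 ℕ.^_) (List.length-++ σ)) (ℕ.^-distribˡ-+-* 2 (length σ) (length τ)))
         (value-++ σ τ) ⟩
  bit b ℕ.* (2 ℕ.^ length σ ℕ.* 2 ℕ.^ length τ) ℕ.+ (value σ ℕ.* 2 ℕ.^ length τ ℕ.+ value τ)
    ≡⟨ solve 5 (λ b p q v w → b :* (p :* q) :+ (v :* q :+ w) := (b :* p :+ v) :* q :+ w) refl
         (bit b) (2 ℕ.^ length σ) (2 ℕ.^ length τ) (value σ) (value τ) ⟩
  value (b ∷ σ) ℕ.* 2 ℕ.^ length τ ℕ.+ value τ ∎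
  where open ≡-Reasoning

value<2^length : ∀ σ → value σ ℕ.< 2 ℕ.^ length σ
value<2^length []          = s≤s z≤n
value<2^length (false ∷ σ) = ℕ.<-≤-trans (value<2^length σ) (ℕ.m≤m+n _ _)
value<2^length (true ∷ σ)  = subst (ℕ._< 2 ℕ.^ suc (length σ))
  (cong (ℕ._+ value σ) (sym (ℕ.*-identityˡ (2 ℕ.^ length σ))))
  (subst (2 ℕ.^ length σ ℕ.+ value σ ℕ.<_)
    (cong (2 ℕ.^ length σ ℕ.+_) (sym (ℕ.+-identityʳ _)))
    (ℕ.+-monoʳ-< (2 ℕ.^ length σ) (value<2^length σ)))

value-bits : ∀ l n → n ≡ n ≫ l ℕ.* 2 ℕ.^ l ℕ.+ value (bits l n)
value-bits zero    n = sym (trans (ℕ.+-identityʳ _) (ℕ.*-identityʳ n))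
value-bits (suc l) n = begin
  n
    ≡⟨ value-bits l n ⟩
  n ≫ l ℕ.* 2 ℕ.^ l ℕ.+ value (bits l n)
    ≡⟨ cong (λ m → m ℕ.* 2 ℕ.^ l ℕ.+ value (bits l n)) (proj₂ (halve (n ≫ l))) ⟩
  (bit (odd? (n ≫ l)) ℕ.+ 2 ℕ.* (n ≫ suc l)) ℕ.* 2 ℕ.^ l ℕ.+ value (bits l n)
    ≡⟨ solve 4 (λ b h p v → (b :+ con 2 :* h) :* p :+ v := h :* (con 2 :* p) :+ (b :* p :+ v)) refl
         (bit (odd? (n ≫ l))) (n ≫ suc l) (2 ℕ.^ l) (value (bits l n)) ⟩
  n ≫ suc l ℕ.* 2 ℕ.^ suc l ℕ.+ (bit (odd? (n ≫ l)) ℕ.* 2 ℕ.^ l ℕ.+ value (bits l n))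
    ≡⟨ cong (λ m → n ≫ suc l ℕ.* 2 ℕ.^ suc l ℕ.+
                   (bit (odd? (n ≫ l)) ℕ.* 2 ℕ.^ m ℕ.+ value (bits l n)))
         (length-bits l n) ⟨
  n ≫ suc l ℕ.* 2 ℕ.^ suc l ℕ.+ value (bits (suc l) n) ∎
  where open ≡-Reasoning

value-bits-< : ∀ l n → n ℕ.< 2 ℕ.^ l → value (bits l n) ≡ n
value-bits-< l n n<2^l = sym (trans (value-bits l n)
  (cong (λ m → m ℕ.* 2 ℕ.^ l ℕ.+ value (bits l n)) ≫≡0))
  where
  ≫≡0 : n ≫ l ≡ 0
  ≫≡0 = ℕ.n<1⇒n≡0 (ℕ.*-cancelʳ-< (2 ℕ.^ l) (n ≫ l) 1 (ℕ.≤-<-trans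
    (ℕ.≤-trans (ℕ.m≤m+n _ _) (ℕ.≤-reflexive (sym (value-bits l n))))
    (subst (n ℕ.<_) (sym (ℕ.*-identityˡ _)) n<2^l)))

prefix⇒++ : ∀ {σ σ′ : Str} → Prefix _≡_ σ σ′ → ∃ λ τ → σ′ ≡ σ ++ τ
prefix⇒++ []         = _ , refl
prefix⇒++ (refl ∷ p) = map₂ (cong (_ ∷_)) (prefix⇒++ p)

-- The canonical prefix code for nondecreasing word lengths: increment the previous word as a
-- binary numeral and pad it with zeros on the right.
module KraftCode {g : ℕ → ℕ} (g-recursive : Recursive₁ g) where
  -- wordLength n = max { g i ∣ i ≤ n }.
  wordLength : ℕ → ℕ
  wordLength zero    = g 0
  wordLength (suc n) = wordLength n ℕ.+ (g (suc n) ∸ wordLength n)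

  -- `numeral n` divided by 2^(wordLength n) is the sum of 2^(-wordLength i) over i < n.
  numeral : ℕ → ℕ
  numeral zero    = 0
  numeral (suc n) = suc (numeral n) ℕ.* 2 ℕ.^ (g (suc n) ∸ wordLength n)

  wordLength-recursive : Recursive₁ wordLength
  wordLength-recursive = primrec₁ (uncurry₂ (λ n y → y ℕ.+ (g (suc n) ∸ y))
    (app₂ +-recursive (var 1F) (app₂ ∸-recursive
      (app₁ g-recursive (app₁ suc-recursive (var 0F))) (var 1F))))
    (λ _ → refl)

  numeral-recursive : Recursive₁ numeral
  numeral-recursive = primrec₁ (uncurry₂ (λ n y → suc y ℕ.* 2 ℕ.^ (g (suc n) ∸ wordLength n))
    (app₂ *-recursive (app₁ suc-recursive (var 1F)) (app₁ 2^-recursive (app₂ ∸-recursive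
      (app₁ g-recursive (app₁ suc-recursive (var 0F))) (app₁ wordLength-recursive (var 0F))))))
    (λ _ → refl)

  g≤wordLength : ∀ n → g n ℕ.≤ wordLength n
  g≤wordLength zero    = ℕ.≤-refl
  g≤wordLength (suc n) = ℕ.m≤n+m∸n (g (suc n)) (wordLength n)

  wordLength-mono : ∀ {m n} → m ℕ.≤′ n → wordLength m ℕ.≤ wordLength n
  wordLength-mono ℕ.≤′-refl       = ℕ.≤-refl
  wordLength-mono (ℕ.≤′-step m≤n) = ℕ.≤-trans (wordLength-mono m≤n) (ℕ.m≤m+n _ _)

  -- In terms of dyadic rationals: (numeral m + 1) / 2^(wordLength m) ≤ numeral n / 2^(wordLength n).
  numeral-< : ∀ {m n} → suc m ℕ.≤′ n →
    suc (numeral m) ℕ.* 2 ℕ.^ wordLength n ℕ.≤ numeral n ℕ.* 2 ℕ.^ wordLength m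
  numeral-< {m} ℕ.≤′-refl = ℕ.≤-reflexive (trans
    (cong (suc (numeral m) ℕ.*_) (ℕ.^-distribˡ-+-* 2 (wordLength m) d))
    (solve 3 (λ k p q → k :* (p :* q) := k :* q :* p) refl
      (suc (numeral m)) (2 ℕ.^ wordLength m) (2 ℕ.^ d)))
    where
    d : ℕ
    d = g (suc m) ∸ wordLength m
  numeral-< {m} {suc n} (ℕ.≤′-step m<n) = begin
    suc (numeral m) ℕ.* 2 ℕ.^ wordLength (suc n)
      ≡⟨ cong (suc (numeral m) ℕ.*_) (ℕ.^-distribˡ-+-* 2 (wordLength n) d) ⟩
    suc (numeral m) ℕ.* (2 ℕ.^ wordLength n ℕ.* 2 ℕ.^ d)
      ≡⟨ ℕ.*-assoc (suc (numeral m)) (2 ℕ.^ wordLength n) (2 ℕ.^ d) ⟨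
    suc (numeral m) ℕ.* 2 ℕ.^ wordLength n ℕ.* 2 ℕ.^ d
      ≤⟨ ℕ.*-monoˡ-≤ (2 ℕ.^ d) (numeral-< m<n) ⟩
    numeral n ℕ.* 2 ℕ.^ wordLength m ℕ.* 2 ℕ.^ d
      ≤⟨ ℕ.*-monoˡ-≤ (2 ℕ.^ d) (ℕ.*-monoˡ-≤ (2 ℕ.^ wordLength m) (ℕ.n≤1+n (numeral n))) ⟩
    suc (numeral n) ℕ.* 2 ℕ.^ wordLength m ℕ.* 2 ℕ.^ d
      ≡⟨ solve 3 (λ k p q → k :* p :* q := k :* q :* p) refl
           (suc (numeral n)) (2 ℕ.^ wordLength m) (2 ℕ.^ d) ⟩
    numeral (suc n) ℕ.* 2 ℕ.^ wordLength m ∎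
    where
    open ℕ.≤-Reasoning
    d : ℕ
    d = g (suc n) ∸ wordLength n

  module _ (s : ℕ) (numeral<2^ : ∀ n → numeral n ℕ.< 2 ℕ.^ (wordLength n ℕ.+ s)) where
    -- The Kraft sum is only bounded, possibly by more than 1; the `s` extra digits make room for
    -- the larger numerals.
    codeword : ℕ → Str
    codeword n = bits (wordLength n ℕ.+ s) (numeral n)

    length-codeword : ∀ n → length (codeword n) ≡ wordLength n ℕ.+ s
    length-codeword n = length-bits (wordLength n ℕ.+ s) (numeral n)

    value-codeword : ∀ n → value (codeword n) ≡ numeral n
    value-codeword n = value-bits-< (wordLength n ℕ.+ s) (numeral n) (numeral<2^ n)

    codeword-recursive : Recursive₁ (λ n → ⌜ codeword n ⌝)
    codeword-recursive = uncurry₁ _ (app₂ bits-recursive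
      (app₂ +-recursive (app₁ wordLength-recursive (var 0F)) (const s))
      (app₁ numeral-recursive (var 0F)))

    ++-length : ∀ m n {τ} → codeword n ≡ codeword m ++ τ →
      wordLength n ≡ wordLength m ℕ.+ length τ
    ++-length m n {τ} eq = ℕ.+-cancelʳ-≡ s _ _ (begin
      wordLength n ℕ.+ s                  ≡⟨ length-codeword n ⟨
      length (codeword n)                 ≡⟨ cong length eq ⟩
      length (codeword m ++ τ)            ≡⟨ List.length-++ (codeword m) ⟩
      length (codeword m) ℕ.+ length τ    ≡⟨ cong (ℕ._+ length τ) (length-codeword m) ⟩
      wordLength m ℕ.+ s ℕ.+ length τ     ≡⟨ solve 3 (λ a b c → a :+ b :+ c := a :+ c :+ b) refl
                                               (wordLength m) s (length τ) ⟩
      wordLength m ℕ.+ length τ ℕ.+ s     ∎)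
      where open ≡-Reasoning

    -- An extension of the word of `m` denotes a dyadic number smaller than (numeral m + 1) /
    -- 2^(wordLength m), whereas `numeral-<` puts every later numeral at or above that bound.
    codeword-<-++ : ∀ m n {τ} → m ℕ.< n → codeword n ≢ codeword m ++ τ
    codeword-<-++ m n {τ} m<n eq = ℕ.<⇒≱ numeral< (numeral-< (ℕ.≤⇒≤′ m<n))
      where
      numeral≡ : numeral n ≡ numeral m ℕ.* 2 ℕ.^ length τ ℕ.+ value τ
      numeral≡ = trans (sym (value-codeword n)) (trans (cong value eq)
        (trans (value-++ (codeword m) τ)
          (cong (λ v → v ℕ.* 2 ℕ.^ length τ ℕ.+ value τ) (value-codeword m))))
      numeral< : numeral n ℕ.* 2 ℕ.^ wordLength m ℕ.< suc (numeral m) ℕ.* 2 ℕ.^ wordLength n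
      numeral< = begin-strict
        numeral n ℕ.* 2 ℕ.^ wordLength m
          ≡⟨ cong (ℕ._* 2 ℕ.^ wordLength m) numeral≡ ⟩
        (numeral m ℕ.* 2 ℕ.^ length τ ℕ.+ value τ) ℕ.* 2 ℕ.^ wordLength m
          <⟨ ℕ.*-monoˡ-< (2 ℕ.^ wordLength m) ⦃ ℕ.m^n≢0 2 (wordLength m) ⦄
               (ℕ.+-monoʳ-< (numeral m ℕ.* 2 ℕ.^ length τ) (value<2^length τ)) ⟩
        (numeral m ℕ.* 2 ℕ.^ length τ ℕ.+ 2 ℕ.^ length τ) ℕ.* 2 ℕ.^ wordLength m
          ≡⟨ solve 3 (λ k p q → (k :* p :+ p) :* q := (con 1 :+ k) :* (q :* p)) refl
               (numeral m) (2 ℕ.^ length τ) (2 ℕ.^ wordLength m) ⟩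
        suc (numeral m) ℕ.* (2 ℕ.^ wordLength m ℕ.* 2 ℕ.^ length τ)
          ≡⟨ cong (suc (numeral m) ℕ.*_) (ℕ.^-distribˡ-+-* 2 (wordLength m) (length τ)) ⟨
        suc (numeral m) ℕ.* 2 ℕ.^ (wordLength m ℕ.+ length τ)
          ≡⟨ cong (λ l → suc (numeral m) ℕ.* 2 ℕ.^ l) (++-length m n eq) ⟨
        suc (numeral m) ℕ.* 2 ℕ.^ wordLength n ∎
        where open ℕ.≤-Reasoning

    codeword-prefix-free : PrefixFreeFamily codeword
    codeword-prefix-free m n p with ℕ.<-cmp m n | prefix⇒++ p
    ... | tri≈ _ m≡n _ | _      = m≡n
    ... | tri< m<n _ _ | τ , eq = contradiction eq (codeword-<-++ m n m<n)
    -- With `τ` empty the two words coincide, so the previous case applies with the indices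
    -- exchanged.
    ... | tri> _ _ n<m | []    , eq =
      contradiction (trans (sym (List.++-identityʳ _)) (trans (sym eq) (sym (List.++-identityʳ _))))
        (codeword-<-++ n m n<m)
    -- Otherwise the smaller index has the strictly longer word, against the monotonicity of
    -- `wordLength`.
    ... | tri> _ _ n<m | b ∷ τ , eq = contradiction
      (ℕ.≤-trans (ℕ.m<m+n _ (s≤s z≤n)) (ℕ.≤-trans (ℕ.≤-reflexive (sym (++-length m n eq)))
        (wordLength-mono (ℕ.≤⇒≤′ (ℕ.<⇒≤ n<m)))))
      (ℕ.<-irrefl refl)

-- Reals and integral bounds

fromℚᵘ-mono-≤ : ∀ {p q} → p ℚᵘ.≤ q → ℚ.fromℚᵘ p ℚ.≤ ℚ.fromℚᵘ q
fromℚᵘ-mono-≤ {p} {q} p≤q = ℚ.toℚᵘ-cancel-≤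
  (ℚᵘ.≤-respˡ-≃ (ℚᵘ.≃-sym (ℚ.toℚᵘ-fromℚᵘ p)) (ℚᵘ.≤-respʳ-≃ (ℚᵘ.≃-sym (ℚ.toℚᵘ-fromℚᵘ q)) p≤q))

fromℚᵘ-mono-< : ∀ {p q} → p ℚᵘ.< q → ℚ.fromℚᵘ p ℚ.< ℚ.fromℚᵘ q
fromℚᵘ-mono-< {p} {q} p<q = ℚ.toℚᵘ-cancel-<
  (ℚᵘ.<-respˡ-≃ (ℚᵘ.≃-sym (ℚ.toℚᵘ-fromℚᵘ p)) (ℚᵘ.<-respʳ-≃ (ℚᵘ.≃-sym (ℚ.toℚᵘ-fromℚᵘ q)) p<q))

ι : ℕ → ℚ
ι n = + n ℚ./ 1

ι-mono-≤ : ∀ {m n} → m ℕ.≤ n → ι m ℚ.≤ ι n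
ι-mono-≤ {m} {n} m≤n = fromℚᵘ-mono-≤ {mkℚᵘ (+ m) 0} {mkℚᵘ (+ n) 0}
  (ℚᵘ.*≤* (ℤ.*-monoʳ-≤-nonNeg (+ 1) (ℤ.+≤+ m≤n)))

ι-mono-< : ∀ {m n} → m ℕ.< n → ι m ℚ.< ι n
ι-mono-< {m} {n} m<n = fromℚᵘ-mono-< {mkℚᵘ (+ m) 0} {mkℚᵘ (+ n) 0}
  (ℚᵘ.*<* (ℤ.*-monoʳ-<-pos (+ 1) (ℤ.+<+ m<n)))

ι-cancel-≤ : ∀ {m n} → ι m ℚ.≤ ι n → m ℕ.≤ n
ι-cancel-≤ ιm≤ιn = ℕ.≮⇒≥ (λ n<m → ℚ.<-irrefl refl (ℚ.<-≤-trans (ι-mono-< n<m) ιm≤ιn))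

ι-cancel-< : ∀ {m n} → ι m ℚ.< ι n → m ℕ.< n
ι-cancel-< ιm<ιn = ℕ.≰⇒> (λ n≤m → ℚ.<-irrefl refl (ℚ.<-≤-trans ιm<ιn (ι-mono-≤ n≤m)))

ι-homo-+ : ∀ m n → ι (m ℕ.+ n) ≡ ι m ℚ.+ ι n
ι-homo-+ m n = ℚ.toℚᵘ-injective (begin
  ℚ.toℚᵘ (ι (m ℕ.+ n))                  ≈⟨ ℚ.toℚᵘ-fromℚᵘ (mkℚᵘ (+ (m ℕ.+ n)) 0) ⟩
  mkℚᵘ (+ (m ℕ.+ n)) 0                  ≈⟨ ℚᵘ.*≡* (cong (ℤ._* + 1) (cong₂ ℤ._+_
                                             (sym (ℤ.*-identityʳ (+ m))) (sym (ℤ.*-identityʳ (+ n))))) ⟩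
  mkℚᵘ (+ m) 0 ℚᵘ.+ mkℚᵘ (+ n) 0        ≈⟨ ℚᵘ.+-cong (ℚ.toℚᵘ-fromℚᵘ (mkℚᵘ (+ m) 0))
                                             (ℚ.toℚᵘ-fromℚᵘ (mkℚᵘ (+ n) 0)) ⟨
  ℚ.toℚᵘ (ι m) ℚᵘ.+ ℚ.toℚᵘ (ι n)        ≈⟨ ℚ.toℚᵘ-homo-+ (ι m) (ι n) ⟨
  ℚ.toℚᵘ (ι m ℚ.+ ι n)                  ∎)
  where open ℚᵘ.≃-Reasoning

ι-homo-* : ∀ m n → ι (m ℕ.* n) ≡ ι m ℚ.* ι n
ι-homo-* m n = ℚ.toℚᵘ-injective (begin
  ℚ.toℚᵘ (ι (m ℕ.* n))                  ≈⟨ ℚ.toℚᵘ-fromℚᵘ (mkℚᵘ (+ (m ℕ.* n)) 0) ⟩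
  mkℚᵘ (+ (m ℕ.* n)) 0                  ≈⟨ ℚᵘ.*≡* (cong (ℤ._* + 1) (ℤ.pos-* m n)) ⟩
  mkℚᵘ (+ m) 0 ℚᵘ.* mkℚᵘ (+ n) 0        ≈⟨ ℚᵘ.*-cong (ℚ.toℚᵘ-fromℚᵘ (mkℚᵘ (+ m) 0))
                                             (ℚ.toℚᵘ-fromℚᵘ (mkℚᵘ (+ n) 0)) ⟨
  ℚ.toℚᵘ (ι m) ℚᵘ.* ℚ.toℚᵘ (ι n)        ≈⟨ ℚ.toℚᵘ-homo-* (ι m) (ι n) ⟨
  ℚ.toℚᵘ (ι m ℚ.* ι n)                  ∎)
  where open ℚᵘ.≃-Reasoning

ι-homo-^ : ∀ m n → ι (m ℕ.^ n) ≡ ι m ^ n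
ι-homo-^ m zero    = refl
ι-homo-^ m (suc n) = trans (ι-homo-* m (m ℕ.^ n)) (cong (ι m ℚ.*_) (ι-homo-^ m n))

0≤ι : ∀ n → 0ℚ ℚ.≤ ι n
0≤ι n = ι-mono-≤ {0} {n} z≤n

≤ι : ∀ q → ∃ λ n → q ℚ.≤ ι n
≤ι q@(ℚ.mkℚ a d _) = ℤ.∣ a ∣ , subst (ℚ._≤ ι ℤ.∣ a ∣) (ℚ.↥p/↧p≡p q)
  (fromℚᵘ-mono-≤ {mkℚᵘ a d} {mkℚᵘ (+ ℤ.∣ a ∣) 0} (ℚᵘ.*≤* (ℤ.≤-trans (bound a)
    (ℤ.*-monoˡ-≤-nonNeg (+ ℤ.∣ a ∣) (ℤ.+≤+ (s≤s (z≤n {d})))))))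
  where
  bound : ∀ a → a ℤ.* + 1 ℤ.≤ + ℤ.∣ a ∣ ℤ.* + 1
  bound (+ _)    = ℤ.≤-refl
  bound -[1+ _ ] = ℤ.-≤+

≤⇒≥∉ : ∀ {q r} x → fromℚ q ≤ x → ¬ below x r → q ℚ.≤ r
≤⇒≥∉ x q≤x r∉x = ℚ.≮⇒≥ (λ r<q → r∉x (q≤x _ r<q))

fromℚ-cancel-≤ : ∀ {p q} → fromℚ p ≤ fromℚ q → p ℚ.≤ q
fromℚ-cancel-≤ {q = q} p≤q = ≤⇒≥∉ (fromℚ q) p≤q (ℚ.<-irrefl refl)

fromℕ-cancel-≤ : ∀ {m n} → fromℕ m ≤ fromℕ n → m ℕ.≤ n
fromℕ-cancel-≤ {m} {n} m≤n = ι-cancel-≤ (fromℚ-cancel-≤ {ι m} {ι n} m≤n)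

-<⇒<+ : ∀ p {q r} → q ℚ.- p ℚ.< r → q ℚ.< r ℚ.+ p
-<⇒<+ p {q} {r} q-p<r = subst₂ ℚ._<_ (trans (ℚ.+-comm (q ℚ.- p) p) (p+[q-p]≡q p q)) refl
  (ℚ.+-monoˡ-< p q-p<r)

<+⇒-< : ∀ p {q r} → q ℚ.< r ℚ.+ p → q ℚ.- p ℚ.< r
<+⇒-< p {q} {r} q<r+p = subst (q ℚ.- p ℚ.<_)
  (trans (cong (ℚ._- p) (ℚ.+-comm r p)) ([p+q]-p≡q p r)) (ℚ.+-monoˡ-< (ℚ.- p) q<r+p)

-- For `r` below `p + q`, any `s` strictly between `r - q` and `p` splits `r` into parts below `p`
-- and `q`.
+-mono-fromℚ-≤ : ∀ {p q} x y → fromℚ p ≤ x → fromℚ q ≤ y → fromℚ (p ℚ.+ q) ≤ x + y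
+-mono-fromℚ-≤ {p} {q} x y p≤x q≤y r r<p+q
  with s , r-q<s , s<p ← ℚ.<-dense (<+⇒-< q r<p+q) =
  s , p≤x s s<p , q≤y (r ℚ.- s) (<+⇒-< s (subst (r ℚ.<_) (ℚ.+-comm s q) (-<⇒<+ q r-q<s)))

-≤⇒≤+ : ∀ x c k → x - fromℕ c ≤ fromℕ k → x ≤ fromℕ (k ℕ.+ c)
-- Membership in a negated cut needs strict room; the increase from `q` to `q′` provides it.
-≤⇒≤+ x c k x-c≤k q q∈x with q′ , q<q′ , q′∈x ← open′ x q∈x =
  subst (q ℚ.<_) (sym (ι-homo-+ k c)) (-<⇒<+ (ι c) (x-c≤k (q ℚ.- ι c)
    (q′ , q′∈x , ℚ.- ι c , lt , λ c<c → ℚ.<-irrefl refl (subst (ℚ._< ι c) (neg-neg (ι c)) c<c))))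
  where
  lt : q ℚ.- ι c ℚ.- q′ ℚ.< ℚ.- ι c
  lt = <+⇒-< q′ (subst (q ℚ.- ι c ℚ.<_) (ℚ.+-comm q′ (ℚ.- ι c)) (ℚ.+-monoˡ-< (ℚ.- ι c) q<q′))

-- Comparisons between integer values are recursive, unlike those between computable reals. The
-- error of at most 3 disappears in the additive constants.
record IsRounding (g : ℕ → ℝ) (G : ℕ → ℕ) : Set where
  field
    recursive : Recursive₁ G
    upper     : ∀ n → g n ≤ fromℕ (G n)
    lower     : ∀ n → fromℕ (G n ∸ 3) ≤ g n

-- G n is ⌈ q ⌉ + 1 for a rational q within 1 of g n, where a negative q counts as 0.
round : ∀ g → Computable g → NonNegative g → ∃ (IsRounding g)
round g (q , (a , b , d , a-rec , b-rec , d-rec , q≡) , approx) g≥0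
  with G , G-rec , first ← minimize {λ m n → (a n 0 ∸ b n 0) ∸ m ℕ.* suc (d n 0)}
         (uncurry₂ _ (app₂ ∸-recursive
           (app₂ ∸-recursive (app₂ a-rec (var 1F) (const 0)) (app₂ b-rec (var 1F) (const 0)))
           (app₂ *-recursive (var 0F) (app₁ suc-recursive (app₂ d-rec (var 1F) (const 0))))))
         (λ n → a n 0 ∸ b n 0 , ℕ.m≤n⇒m∸n≡0 (ℕ.m≤m*n (a n 0 ∸ b n 0) (suc (d n 0)))) =
  suc ∘ G , record
    { recursive = uncurry₁ _ (app₁ suc-recursive (app₁ G-rec (var 0F)))
    ; upper     = upper
    ; lower     = λ n → lower n (G n) (first n)
    }
  where
  upper : ∀ n → g n ≤ fromℕ (suc (G n))
  upper n r r∈ = ℚ.<-≤-trans (proj₂ (approx n 0) r r∈)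
    (subst (q n 0 ℚ.+ 1ℚ ℚ.≤_) (trans (sym (ι-homo-+ (G n) 1)) (cong ι (ℕ.+-comm (G n) 1)))
      (ℚ.+-monoˡ-≤ 1ℚ (subst (ℚ._≤ ι (G n)) (sym (q≡ n 0))
        (fromℚᵘ-mono-≤ {mkℚᵘ (a n 0 ℤ.⊖ b n 0) (d n 0)} {mkℚᵘ (+ G n) 0} (ℚᵘ.*≤* (begin
          (a n 0 ℤ.⊖ b n 0) ℤ.* + 1        ≡⟨ ℤ.*-identityʳ _ ⟩
          a n 0 ℤ.⊖ b n 0                  ≤⟨ ⊖≤∸ (a n 0) (b n 0) ⟩
          + (a n 0 ∸ b n 0)                ≤⟨ ℤ.+≤+ (ℕ.m∸n≡0⇒m≤n (proj₁ (first n))) ⟩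
          + (G n ℕ.* suc (d n 0))          ≡⟨ ℤ.pos-* (G n) (suc (d n 0)) ⟩
          + G n ℤ.* + suc (d n 0)          ∎))))))
    where
    open ℤ.≤-Reasoning
    ⊖≤∸ : ∀ m n → m ℤ.⊖ n ℤ.≤ + (m ∸ n)
    ⊖≤∸ m n with n ℕ.≤? m
    ... | yes n≤m = ℤ.≤-reflexive (ℤ.⊖-≥ n≤m)
    ... | no n≰m  = subst (ℤ._≤ + (m ∸ n)) (sym (ℤ.⊖-≰ n≰m)) ℤ.neg-≤-pos
  lower : ∀ n m → IsFirstZero (λ k → (a n 0 ∸ b n 0) ∸ k ℕ.* suc (d n 0)) m →
    fromℕ (m ∸ 2) ≤ g n
  lower n zero          _ = g≥0 n
  lower n (suc zero)    _ = g≥0 n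
  -- Minimality puts `suc m` strictly below the rational approximation, which exceeds `g n` by at
  -- most 1.
  lower n (suc (suc m)) (_ , below) r r<m = proj₁ (approx n 0) r (ℚ.<-trans r<m
    (subst (ℚ._< q n 0 ℚ.- 1ℚ) (ι-1 m) (ℚ.+-monoˡ-< (ℚ.- 1ℚ) ι<q)))
    where
    ι-1 : ∀ m → ι (suc m) ℚ.- 1ℚ ≡ ι m
    ι-1 m = trans (cong (ℚ._- 1ℚ) (ι-homo-+ 1 m)) ([p+q]-p≡q 1ℚ (ι m))
    lt : suc m ℕ.* suc (d n 0) ℕ.< a n 0 ∸ b n 0
    lt = ℕ.≰⇒> (λ ≤ → below (suc m) ℕ.≤-refl (ℕ.m≤n⇒m∸n≡0 ≤))
    ⊖≡∸ : a n 0 ℤ.⊖ b n 0 ≡ + (a n 0 ∸ b n 0)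
    ⊖≡∸ = ℤ.⊖-≥ (ℕ.<⇒≤ (ℕ.m∸n≢0⇒n<m {a n 0} {b n 0} (ℕ.m<n⇒n≢0 lt)))
    ι<q : ι (suc m) ℚ.< q n 0
    ι<q = subst (ι (suc m) ℚ.<_) (sym (q≡ n 0))
      (fromℚᵘ-mono-< {mkℚᵘ (+ suc m) 0} {mkℚᵘ (a n 0 ℤ.⊖ b n 0) (d n 0)} (ℚᵘ.*<* (begin-strict
        + suc m ℤ.* + suc (d n 0)          ≡⟨ ℤ.pos-* (suc m) (suc (d n 0)) ⟨
        + (suc m ℕ.* suc (d n 0))          <⟨ ℤ.+<+ lt ⟩
        + (a n 0 ∸ b n 0)                  ≡⟨ ⊖≡∸ ⟨
        a n 0 ℤ.⊖ b n 0                    ≡⟨ ℤ.*-identityʳ _ ⟨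
        (a n 0 ℤ.⊖ b n 0) ℤ.* + 1          ∎)))
      where open ℤ.≤-Reasoning

-- Divergence of the difference in integer form: unfolding the cut of `f n - g n` at `D` gives `s`
-- below `f n` and `t` with b ≤ - t and D < s + t, whence b + D < s < a.
gap : ∀ (f g : ℕ → ℝ) → TendsTo∞ (λ n → f n - g n) → ∀ D → ∃ λ N → ∀ n → N ℕ.≤ n → ∀ a b →
  f n ≤ fromℕ a → fromℕ b ≤ g n → b ℕ.+ D ℕ.< a
gap f g tends D with N , large ← tends (fromℕ (suc D)) = N , bound
  where
  bound : ∀ n → N ℕ.≤ n → ∀ a b → f n ≤ fromℕ a → fromℕ b ≤ g n → b ℕ.+ D ℕ.< a
  bound n N≤n a b f≤a b≤g
    with s , s∈f , t , D-s<t , -t∉g ← large n N≤n (ι D) (ι-mono-< {D} ℕ.≤-refl) =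
    ι-cancel-< (begin-strict
    ι (b ℕ.+ D)           ≡⟨ ι-homo-+ b D ⟩
    ι b ℚ.+ ι D           ≤⟨ ℚ.+-monoˡ-≤ (ι D) (≤⇒≥∉ (g n) b≤g -t∉g) ⟩
    ℚ.- t ℚ.+ ι D         ≡⟨ ℚ.+-comm (ℚ.- t) (ι D) ⟩
    ι D ℚ.- t             <⟨ <+⇒-< t (subst (ι D ℚ.<_) (ℚ.+-comm t s) (-<⇒<+ s D-s<t)) ⟩
    s                     <⟨ f≤a s s∈f ⟩
    ι a                   ∎)
    where open ℚ.≤-Reasoning

-- Comparison of `exp₂` with integer powers of two

bernoulli : ∀ y n → y ℕ.^ suc n ℕ.+ suc n ℕ.* y ℕ.^ n ℕ.≤ suc y ℕ.^ suc n
bernoulli y zero    = ℕ.≤-reflexive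
  (solve 1 (λ y → y :* con 1 :+ con 1 := (con 1 :+ y) :* con 1) refl y)
bernoulli y (suc n) = begin
  y ℕ.* (y ℕ.* p) ℕ.+ (2 ℕ.+ n) ℕ.* (y ℕ.* p)
    ≤⟨ ℕ.m≤m+n _ (suc n ℕ.* p) ⟩
  y ℕ.* (y ℕ.* p) ℕ.+ (2 ℕ.+ n) ℕ.* (y ℕ.* p) ℕ.+ suc n ℕ.* p
    ≡⟨ solve 3 (λ y n p → y :* (y :* p) :+ (con 2 :+ n) :* (y :* p) :+ (con 1 :+ n) :* p :=
                          (con 1 :+ y) :* (y :* p :+ (con 1 :+ n) :* p)) refl y n p ⟩
  suc y ℕ.* (y ℕ.^ suc n ℕ.+ suc n ℕ.* p)
    ≤⟨ ℕ.*-monoʳ-≤ (suc y) (bernoulli y n) ⟩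
  suc y ℕ.* suc y ℕ.^ suc n ∎
  where
  open ℕ.≤-Reasoning
  p : ℕ
  p = y ℕ.^ n

-- Take n = y in `bernoulli`: the second term (y+1) y^y equals y^(y+1) + y^y, and y^y is positive
-- even for y = 0.
2y^[1+y]<[1+y]^[1+y] : ∀ y → 2 ℕ.* y ℕ.^ suc y ℕ.< suc y ℕ.^ suc y
2y^[1+y]<[1+y]^[1+y] y = ℕ.<-≤-trans
  (subst (2 ℕ.* y ℕ.^ suc y ℕ.<_)
    (solve 2 (λ y p → con 2 :* (y :* p) :+ p := y :* p :+ (con 1 :+ y) :* p) refl y (y ℕ.^ y))
    (ℕ.m<m+n _ (y^y>0 y)))
  (bernoulli y y)
  where
  y^y>0 : ∀ y → 0 ℕ.< y ℕ.^ y
  y^y>0 zero    = s≤s z≤n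
  y^y>0 (suc y) = ℕ.m^n>0 (suc y) (suc y)

-- Already 2^(M + 1 - 1/(y+1)) exceeds y, because 2 y^(y+1) < (y+1)^(y+1) ≤ 2^((M+1)(y+1)).
fromℕ<exp₂ : ∀ {y} M → y ℕ.< 2 ℕ.^ suc M → fromℕ y < exp₂ (fromℕ (suc M))
fromℕ<exp₂ {y} M y<2^1+M = ι y , (s , s<1+M , lt) , ℚ.<-irrefl refl
  where
  a : ℕ
  a = y ℕ.+ M ℕ.* suc y
  -- 1 + a equals (1 + M)(1 + y), so a common divisor divides 1. Lowest terms matter because `exp₂`
  -- reads off the stored numerator and denominator.
  coprime : Coprime a (suc y)
  coprime {d} (d∣a , d∣1+y) = ∣1⇒≡1 (∣m+n∣m⇒∣n
    (subst (d ∣_) (ℕ.+-comm 1 a) (∣n⇒∣m*n (suc M) d∣1+y)) d∣a)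
  s : ℚ
  s = ℚ.mkℚ (+ a) y coprime
  s<1+M : s ℚ.< ι (suc M)
  s<1+M = subst (ℚ._< ι (suc M)) (ℚ.↥p/↧p≡p s)
    (fromℚᵘ-mono-< {mkℚᵘ (+ a) y} {mkℚᵘ (+ suc M) 0} (ℚᵘ.*<* (subst₂ ℤ._<_
      (sym (ℤ.*-identityʳ (+ a))) (ℤ.pos-* (suc M) (suc y)) (ℤ.+<+ (ℕ.n<1+n a)))))
  y^<2^a : y ℕ.^ suc y ℕ.< 2 ℕ.^ a
  y^<2^a = ℕ.*-cancelˡ-< 2 _ _ (begin-strict
    2 ℕ.* y ℕ.^ suc y            <⟨ 2y^[1+y]<[1+y]^[1+y] y ⟩
    suc y ℕ.^ suc y              ≤⟨ ℕ.^-monoˡ-≤ (suc y) y<2^1+M ⟩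
    (2 ℕ.^ suc M) ℕ.^ suc y      ≡⟨ ℕ.^-*-assoc 2 (suc M) (suc y) ⟩
    2 ℕ.^ suc a                  ∎)
    where open ℕ.≤-Reasoning
  lt : (ι y ℚ.⊔ 0ℚ) ^ suc y ℚ.< 2ℚ ^ a
  lt = subst₂ ℚ._<_
    (trans (ι-homo-^ y (suc y)) (cong (_^ suc y) (sym (ℚ.p≥q⇒p⊔q≡p (0≤ι y)))))
    (ι-homo-^ 2 a) (ι-mono-< y^<2^a)

-- The rational -(n+1) lies strictly below - x, as the open cut demands; this strictness costs one
-- factor ½.
½^≤exp₂ : ∀ x n → x ≤ fromℕ n → fromℚ (½ ^ suc n) ≤ exp₂ (- x)
½^≤exp₂ x n x≤n r r<½^ = ℚ.mkℚ -[1+ n ] 0 coprime , (ℚ.- ι n , lt , n∉x) ,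
  subst (ℚ._< ½ ^ suc n) (sym (ℚ.*-identityʳ _)) (⊔< (ℚ.⊔-sel r 0ℚ))
  where
  ⊔< : r ℚ.⊔ 0ℚ ≡ r ⊎ r ℚ.⊔ 0ℚ ≡ 0ℚ → r ℚ.⊔ 0ℚ ℚ.< ½ ^ suc n
  ⊔< (inj₁ eq) = subst (ℚ._< ½ ^ suc n) (sym eq) r<½^
  ⊔< (inj₂ eq) = subst (ℚ._< ½ ^ suc n) (sym eq) (0<½^ (suc n))
  coprime : Coprime (suc n) 1
  coprime (_ , d∣1) = ∣1⇒≡1 d∣1
  lt : ℚ.mkℚ -[1+ n ] 0 coprime ℚ.< ℚ.- ι n
  lt = subst (ℚ._< ℚ.- ι n) (ℚ.↥p/↧p≡p (ℚ.mkℚ -[1+ n ] 0 coprime))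
    (ℚ.neg-antimono-< (ι-mono-< (ℕ.n<1+n n)))
  n∉x : ¬ below x (ℚ.- (ℚ.- ι n))
  n∉x ∈x = ℚ.<-irrefl refl (x≤n (ι n) (subst (below x) (neg-neg (ι n)) ∈x))

-- The reduction

2^*½^≡1 : ∀ n → 2ℚ ^ n ℚ.* ½ ^ n ≡ 1ℚ
2^*½^≡1 zero    = refl
2^*½^≡1 (suc n) = begin
  (2ℚ ℚ.* 2ℚ ^ n) ℚ.* (½ ℚ.* ½ ^ n)     ≡⟨ cong (ℚ._* (½ ℚ.* ½ ^ n)) (ℚ.*-comm 2ℚ (2ℚ ^ n)) ⟩
  (2ℚ ^ n ℚ.* 2ℚ) ℚ.* (½ ℚ.* ½ ^ n)     ≡⟨ ℚ.*-assoc (2ℚ ^ n) 2ℚ (½ ℚ.* ½ ^ n) ⟩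
  2ℚ ^ n ℚ.* (2ℚ ℚ.* (½ ℚ.* ½ ^ n))     ≡⟨ cong (2ℚ ^ n ℚ.*_) (ℚ.*-assoc 2ℚ ½ (½ ^ n)) ⟨
  2ℚ ^ n ℚ.* (1ℚ ℚ.* ½ ^ n)             ≡⟨ cong (2ℚ ^ n ℚ.*_) (ℚ.*-identityˡ (½ ^ n)) ⟩
  2ℚ ^ n ℚ.* ½ ^ n                      ≡⟨ 2^*½^≡1 n ⟩
  1ℚ                                    ∎
  where open ≡-Reasoning

n<2^n : ∀ n → n ℕ.< 2 ℕ.^ n
n<2^n zero    = s≤s z≤n
n<2^n (suc n) = ℕ.≤-trans (s≤s (n<2^n n))
  (ℕ.+-mono-≤ (ℕ.m^n>0 2 n) (ℕ.m≤m+n (2 ℕ.^ n) 0))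

-- The Kraft inequality for rounded exponents

module _ (x : ℕ → ℝ) {g : ℕ → ℕ} (rounding : IsRounding x g) where
  open IsRounding rounding
  open KraftCode recursive

  private
    a : ℕ → ℝ
    a n = exp₂ (- x n)
    -- Half the sum of 2^(-wordLength i) over i ≤ n; the half matches the factor lost in `½^≤exp₂`.
    dyadic : ℕ → ℚ
    dyadic n = ι (suc (numeral n)) ℚ.* ½ ^ suc (wordLength n)

  dyadic-suc : ∀ n → dyadic (suc n) ≡ dyadic n ℚ.+ ½ ^ suc (wordLength (suc n))
  dyadic-suc n = begin
    ι (1 ℕ.+ k ℕ.* 2 ℕ.^ d) ℚ.* ½ ^ suc (l ℕ.+ d)
      ≡⟨ cong (ℚ._* ½ ^ suc (l ℕ.+ d)) (trans (cong ι (ℕ.+-comm 1 (k ℕ.* 2 ℕ.^ d)))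
           (ι-homo-+ (k ℕ.* 2 ℕ.^ d) 1)) ⟩
    (ι (k ℕ.* 2 ℕ.^ d) ℚ.+ 1ℚ) ℚ.* ½ ^ suc (l ℕ.+ d)
      ≡⟨ ℚ.*-distribʳ-+ (½ ^ suc (l ℕ.+ d)) (ι (k ℕ.* 2 ℕ.^ d)) 1ℚ ⟩
    ι (k ℕ.* 2 ℕ.^ d) ℚ.* ½ ^ suc (l ℕ.+ d) ℚ.+ 1ℚ ℚ.* ½ ^ suc (l ℕ.+ d)
      ≡⟨ cong₂ ℚ._+_ scale (ℚ.*-identityˡ (½ ^ suc (l ℕ.+ d))) ⟩
    dyadic n ℚ.+ ½ ^ suc (l ℕ.+ d) ∎
    where
    open ≡-Reasoning
    k l d : ℕ
    k = suc (numeral n)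
    l = wordLength n
    d = g (suc n) ∸ wordLength n
    scale : ι (k ℕ.* 2 ℕ.^ d) ℚ.* ½ ^ suc (l ℕ.+ d) ≡ ι k ℚ.* ½ ^ suc l
    scale = begin
      ι (k ℕ.* 2 ℕ.^ d) ℚ.* ½ ^ suc (l ℕ.+ d)
        ≡⟨ cong₂ ℚ._*_ (trans (ι-homo-* k (2 ℕ.^ d)) (cong (ι k ℚ.*_) (ι-homo-^ 2 d)))
             (trans (cong (λ m → ½ ^ suc m) (ℕ.+-comm l d))
               (trans (cong (½ ^_) (sym (ℕ.+-suc d l))) (^-homo-* ½ d (suc l)))) ⟩
      (ι k ℚ.* 2ℚ ^ d) ℚ.* (½ ^ d ℚ.* ½ ^ suc l)
        ≡⟨ ℚ.*-assoc (ι k) (2ℚ ^ d) (½ ^ d ℚ.* ½ ^ suc l) ⟩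
      ι k ℚ.* (2ℚ ^ d ℚ.* (½ ^ d ℚ.* ½ ^ suc l))
        ≡⟨ cong (ι k ℚ.*_) (ℚ.*-assoc (2ℚ ^ d) (½ ^ d) (½ ^ suc l)) ⟨
      ι k ℚ.* ((2ℚ ^ d ℚ.* ½ ^ d) ℚ.* ½ ^ suc l)
        ≡⟨ cong (λ p → ι k ℚ.* (p ℚ.* ½ ^ suc l)) (2^*½^≡1 d) ⟩
      ι k ℚ.* (1ℚ ℚ.* ½ ^ suc l)
        ≡⟨ cong (ι k ℚ.*_) (ℚ.*-identityˡ (½ ^ suc l)) ⟩
      ι k ℚ.* ½ ^ suc l ∎

  ½^wordLength≤ : ∀ n → fromℚ (½ ^ suc (wordLength n)) ≤ a n
  ½^wordLength≤ n = ½^≤exp₂ (x n) (wordLength n)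
    λ q q∈ → ℚ.<-≤-trans (upper n q q∈) (ι-mono-≤ (g≤wordLength n))

  dyadic≤partialSum : ∀ n → fromℚ (dyadic n) ≤ partialSum a (suc n)
  dyadic≤partialSum zero    = subst (λ p → fromℚ p ≤ partialSum a 1)
    (trans (ℚ.+-identityˡ (½ ^ suc (wordLength 0))) (sym (ℚ.*-identityˡ (½ ^ suc (wordLength 0)))))
    (+-mono-fromℚ-≤ {0ℚ} {½ ^ suc (wordLength 0)} 0ℝ (a 0) (λ _ q<0 → q<0) (½^wordLength≤ 0))
  dyadic≤partialSum (suc n) = subst (λ p → fromℚ p ≤ partialSum a (2 ℕ.+ n)) (sym (dyadic-suc n))
    (+-mono-fromℚ-≤ {dyadic n} {½ ^ suc (wordLength (suc n))} (partialSum a (suc n)) (a (suc n))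
      (dyadic≤partialSum n) (½^wordLength≤ (suc n)))

  -- The partial sums are bounded by some N ≤ 2^N, hence so is `dyadic n`. Multiplying by
  -- 2^(wordLength n + 1) bounds the numeral, with s = N + 1.
  kraft : Σ[ a ]<∞ → ∃ λ s → ∀ n → numeral n ℕ.< 2 ℕ.^ (wordLength n ℕ.+ s)
  kraft (B , partialSum≤B) with b , b∉B ← bounded B with N , b≤N ← ≤ι b = suc N , λ n →
    ι-cancel-≤ (begin
      ι (suc (numeral n))
        ≡⟨ ℚ.*-identityʳ (ι (suc (numeral n))) ⟨
      ι (suc (numeral n)) ℚ.* 1ℚ
        ≡⟨ cong (ι (suc (numeral n)) ℚ.*_) (trans (ℚ.*-comm (½ ^ suc (wordLength n)) _)
             (2^*½^≡1 (suc (wordLength n)))) ⟨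
      ι (suc (numeral n)) ℚ.* (½ ^ suc (wordLength n) ℚ.* 2ℚ ^ suc (wordLength n))
        ≡⟨ ℚ.*-assoc (ι (suc (numeral n))) (½ ^ suc (wordLength n)) (2ℚ ^ suc (wordLength n)) ⟨
      dyadic n ℚ.* 2ℚ ^ suc (wordLength n)
        ≤⟨ ℚ.*-monoʳ-≤-nonNeg (2ℚ ^ suc (wordLength n))
             ⦃ ℚ.nonNegative (0≤^ 0≤2 (suc (wordLength n))) ⦄
             (ℚ.≤-trans (≤⇒≥∉ B (λ r r<d → partialSum≤B (suc n) r (dyadic≤partialSum n r r<d)) b∉B)
               (ℚ.≤-trans b≤N (ι-mono-≤ (ℕ.<⇒≤ (n<2^n N))))) ⟩
      ι (2 ℕ.^ N) ℚ.* 2ℚ ^ suc (wordLength n)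
        ≡⟨ cong (ι (2 ℕ.^ N) ℚ.*_) (ι-homo-^ 2 (suc (wordLength n))) ⟨
      ι (2 ℕ.^ N) ℚ.* ι (2 ℕ.^ suc (wordLength n))
        ≡⟨ ι-homo-* (2 ℕ.^ N) (2 ℕ.^ suc (wordLength n)) ⟨
      ι (2 ℕ.^ N ℕ.* 2 ℕ.^ suc (wordLength n))
        ≡⟨ cong ι (ℕ.^-distribˡ-+-* 2 N (suc (wordLength n))) ⟨
      ι (2 ℕ.^ (N ℕ.+ suc (wordLength n)))
        ≡⟨ cong (λ m → ι (2 ℕ.^ m))
             (solve 2 (λ N l → N :+ (con 1 :+ l) := l :+ (con 1 :+ N)) refl N (wordLength n)) ⟩
      ι (2 ℕ.^ (wordLength n ℕ.+ suc N)) ∎)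
    where open ℚ.≤-Reasoning

  -- The maximum of the rounded values up to `n` is attained at some i ≤ n, and x i ≤ x n.
  wordLength≤ : Nondecreasing x → ∀ n → fromℕ (wordLength n ∸ 3) ≤ x n
  wordLength≤ x-mono zero    = lower 0
  wordLength≤ x-mono (suc n) with ℕ.≤-total (g (suc n)) (wordLength n)
  ... | inj₁ g≤l = subst (λ m → fromℕ (m ∸ 3) ≤ x (suc n))
    (sym (trans (cong (wordLength n ℕ.+_) (ℕ.m≤n⇒m∸n≡0 g≤l)) (ℕ.+-identityʳ _)))
    (λ q q< → x-mono n (suc n) (ℕ.n≤1+n n) q (wordLength≤ x-mono n q q<))
  ... | inj₂ l≤g = subst (λ m → fromℕ (m ∸ 3) ≤ x (suc n)) (sym (ℕ.m+[n∸m]≡n l≤g)) (lower (suc n))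

-- The functional and the approximate inverse

⌜↾⌝-suc : ∀ X n → ⌜ X ↾ suc n ⌝ ≡ ⌜ X ↾ n ⌝ ℕ.+ 2 ℕ.^ n ℕ.* suc (bit (X n))
⌜↾⌝-suc X n = trans (cong ⌜_⌝ (sym (List.applyUpTo-∷ʳ X n))) (trans (⌜++⌝ (X ↾ n) (X n ∷ []))
  (cong₂ (λ l b → ⌜ X ↾ n ⌝ ℕ.+ 2 ℕ.^ l ℕ.* suc b) (List.length-applyUpTo X n)
    (ℕ.+-identityʳ (bit (X n)))))

prefix-step-recursive : Recursive₃ (λ n y b → y ℕ.+ 2 ℕ.^ n ℕ.* suc b)
prefix-step-recursive = uncurry₃ _ (app₂ +-recursive (var 1F)
  (app₂ *-recursive (app₁ 2^-recursive (var 0F)) (app₁ suc-recursive (var 2F))))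

-- Least significant digits come first, so appending the next oracle bit only adds a term to the
-- code and primitive recursion suffices.
prefix-code : Code ⊤ 1
prefix-code = prec zer (comp (relativize (proj₁ prefix-step-recursive))
  (proj 0F ∷ proj 1F ∷ comp (oracle tt) (proj 0F ∷ []) ∷ []))

prefix-code-⇓ : ∀ {X Y} → (∀ n → Y n ≡ bit (X n)) → ∀ n →
  (λ _ → Y) ⊢ prefix-code · n ∷ [] ⇓ ⌜ X ↾ n ⌝
prefix-code-⇓ Y≡X zero = ⇓prec₀ ⇓zer
prefix-code-⇓ {X} {Y} Y≡X (suc n) = subst ((λ _ → Y) ⊢ prefix-code · suc n ∷ [] ⇓_)
  (trans (cong (λ b → ⌜ X ↾ n ⌝ ℕ.+ 2 ℕ.^ n ℕ.* suc b) (Y≡X n)) (sym (⌜↾⌝-suc X n)))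
  (⇓precₛ (prefix-code-⇓ Y≡X n)
    (⇓comp (⇓proj ∷ ⇓proj ∷ ⇓comp (⇓proj ∷ []) ⇓oracle ∷ [])
      (relativize-⇓ (proj₂ prefix-step-recursive n ⌜ X ↾ n ⌝ (Y n)))))

module _ (f h : ℕ → ℝ) {F H : ℕ → ℕ} (f≈F : IsRounding f F) (h≈H : IsRounding h H) where
  private
    module F = IsRounding f≈F
    module H = IsRounding h≈H

  h≤f⇒H≤F+3 : ∀ {m n} → h n ≤ f m → H n ℕ.≤ F m ℕ.+ 3
  h≤f⇒H≤F+3 {m} {n} h≤f = ℕ.≤-trans (ℕ.m≤n+m∸n (H n) 3) (ℕ.≤-trans
    (ℕ.+-monoʳ-≤ 3 (fromℕ-cancel-≤ λ q q∈ → F.upper m q (h≤f q (H.lower n q q∈))))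
    (ℕ.≤-reflexive (ℕ.+-comm 3 (F m))))

  -- By `h≤f⇒H≤F+3` the number f^inv(h n) passes the recursive test H n ≤ F m + 3, so the least `m`
  -- passing it is no larger.
  approximate-inverse : (em : ExcludedMiddle 0ℓ) (unbounded : Unbounded f) →
    ∃ λ m → Recursive₁ m × (∀ n → H n ℕ.≤ F (m n) ℕ.+ 3) ×
      (∀ n → m n ℕ.≤ inv em f unbounded (h n))
  approximate-inverse em unbounded = via (minimize search-recursive zeros)
    where
    search-recursive : Recursive₂ (λ m n → H n ∸ (F m ℕ.+ 3))
    search-recursive = uncurry₂ _ (app₂ ∸-recursive (app₁ H.recursive (var 1F))
      (app₂ +-recursive (app₁ F.recursive (var 0F)) (const 3)))
    zeros : ∀ n → ∃ λ m → H n ∸ (F m ℕ.+ 3) ≡ 0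
    zeros n = inv em f unbounded (h n) ,
      ℕ.m≤n⇒m∸n≡0 (h≤f⇒H≤F+3 (proj₁ (proj₂ (inv-least em f unbounded (h n)))))
    via : (∃ λ m → Recursive₁ m × (∀ n → IsFirstZero (λ k → H n ∸ (F k ℕ.+ 3)) (m n))) →
      ∃ λ m → Recursive₁ m × (∀ n → H n ℕ.≤ F (m n) ℕ.+ 3) ×
      (∀ n → m n ℕ.≤ inv em f unbounded (h n))
    via (m , m-rec , first) = m , m-rec , (λ n → ℕ.m∸n≡0⇒m≤n (proj₁ (first n))) , λ n →
      IsFirstZero-≤ {λ k → H n ∸ (F k ℕ.+ 3)} (first n) (proj₂ (zeros n))

-- Codes of words of length l reach up to 2^(l+1) - 2, which accounts for the summand 1 in the
-- exponent.
⌜↾⌝<exp₂ : ∀ X {l M} → l ℕ.≤ M → fromℕ ⌜ X ↾ l ⌝ < exp₂ (fromℕ (M ℕ.+ 1))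
⌜↾⌝<exp₂ X {l} {M} l≤M = subst (λ k → fromℕ ⌜ X ↾ l ⌝ < exp₂ (fromℕ k)) (ℕ.+-comm 1 M)
  (fromℕ<exp₂ M (begin-strict
    ⌜ X ↾ l ⌝                    <⟨ ℕ.m<n+m ⌜ X ↾ l ⌝ {2} (s≤s z≤n) ⟩
    2 ℕ.+ ⌜ X ↾ l ⌝              ≤⟨ 2+⌜⌝≤2^[1+length] (X ↾ l) ⟩
    2 ℕ.^ suc (length (X ↾ l))   ≡⟨ cong (λ k → 2 ℕ.^ suc k) (List.length-applyUpTo X l) ⟩
    2 ℕ.^ suc l                  ≤⟨ ℕ.^-monoʳ-≤ 2 (s≤s l≤M) ⟩
    2 ℕ.^ suc M                  ∎))
  where open ℕ.≤-Reasoning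

module _ {U : Code ⊥ 1} (U-universal : Universal U) (f h ĥ : ℕ → ℝ) {F H G m : ℕ → ℕ}
  (f≈F : IsRounding f F) (h≈H : IsRounding h H) (ĥ≈G : IsRounding ĥ G)
  (ĥ-mono : Nondecreasing ĥ) (Σĥ<∞ : Σ[ (λ n → exp₂ (- ĥ n)) ]<∞)
  (h-ĥ→∞ : TendsTo∞ (λ n → h n - ĥ n))
  (H≤F : ∀ n → H n ℕ.≤ F (m n) ℕ.+ 3) where
  open KraftCode (IsRounding.recursive ĥ≈G)

  abstract
    -- The prefix `ρ` followed by the code word of `n` is a program for the value at `n`. The
    -- constant collects the length of `ρ` and the `s` padding digits.
    universal-partial-complexity : ∃ λ r → ∀ {n σ k} →
      φ (universal-partial U-universal) n ⌜ σ ⌝ → K U σ k → k ℕ.≤ r ℕ.+ wordLength n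
    universal-partial-complexity =
      let s , numeral< = kraft ĥ ĥ≈G Σĥ<∞
          ρ , simulates = simulate (codeword-recursive s numeral<) (codeword-prefix-free s numeral<)
                            U-universal (universal-partial U-universal)
      in length ρ ℕ.+ s , λ { {n} ψ↓ (_ , least) → ℕ.≤-trans
        (least _ (ρ ++ codeword s numeral< n , Equivalence.from (simulates n _) ψ↓ , refl))
        (ℕ.≤-reflexive (trans (List.length-++ ρ) (trans
          (cong (length ρ ℕ.+_) (length-codeword s numeral< n))
          (solve 3 (λ r l s → r :+ (l :+ s) := r :+ s :+ l) refl (length ρ) (wordLength n) s)))) }

  -- If X ↾ m n were the value at `n`, its complexity would be at least H n - O(1) and at most
  -- wordLength n + O(1), which the divergence of h - ĥ excludes for large `n`.
  eventually-avoids : ∀ {X} → X ∈ COMPLEX U f → ∃ λ N → ∀ n → N ℕ.≤ n →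
    ¬ φ (universal-partial U-universal) n ⌜ X ↾ m n ⌝
  eventually-avoids {X} (c , complex) =
    -- The 9 collects three errors of 3: from the test defining `m`, from rounding `f`, and from
    -- rounding `ĥ`.
    let N , large = gap h ĥ h-ĥ→∞ (r ℕ.+ c ℕ.+ 9)
    in N , λ n N≤n ψ↓ → ℕ.<⇒≱
      (large n N≤n (H n) (wordLength n ∸ 3) (IsRounding.upper h≈H n) (wordLength≤ ĥ ĥ≈G ĥ-mono n))
      (H≤ n ψ↓)
    where
    open ℕ.≤-Reasoning
    r : ℕ
    r = proj₁ universal-partial-complexity
    H≤ : ∀ n → φ (universal-partial U-universal) n ⌜ X ↾ m n ⌝ →
      H n ℕ.≤ wordLength n ∸ 3 ℕ.+ (r ℕ.+ c ℕ.+ 9)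
    H≤ n ψ↓ = begin
      H n
        ≤⟨ H≤F n ⟩
      F (m n) ℕ.+ 3
        ≤⟨ ℕ.+-monoˡ-≤ 3 (ℕ.m≤n+m∸n (F (m n)) 3) ⟩
      3 ℕ.+ (F (m n) ∸ 3) ℕ.+ 3
        ≤⟨ ℕ.+-monoˡ-≤ 3 (ℕ.+-monoʳ-≤ 3 F∸3≤k+c) ⟩
      3 ℕ.+ (k ℕ.+ c) ℕ.+ 3
        ≤⟨ ℕ.+-monoˡ-≤ 3 (ℕ.+-monoʳ-≤ 3 (ℕ.+-monoˡ-≤ c
             (proj₂ universal-partial-complexity ψ↓ (proj₁ (proj₂ (complex (m n))))))) ⟩
      3 ℕ.+ (r ℕ.+ wordLength n ℕ.+ c) ℕ.+ 3
        ≤⟨ ℕ.+-monoˡ-≤ 3 (ℕ.+-monoʳ-≤ 3 (ℕ.+-monoˡ-≤ c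
             (ℕ.+-monoʳ-≤ r (ℕ.m≤n+m∸n (wordLength n) 3)))) ⟩
      3 ℕ.+ (r ℕ.+ (3 ℕ.+ (wordLength n ∸ 3)) ℕ.+ c) ℕ.+ 3
        ≡⟨ solve 3 (λ r l c → con 3 :+ (r :+ (con 3 :+ l) :+ c) :+ con 3 :=
                              l :+ (r :+ c :+ con 9)) refl r (wordLength n ∸ 3) c ⟩
      wordLength n ∸ 3 ℕ.+ (r ℕ.+ c ℕ.+ 9) ∎
      where
      k : ℕ
      k = proj₁ (complex (m n))
      F∸3≤k+c : F (m n) ∸ 3 ℕ.≤ k ℕ.+ c
      F∸3≤k+c = fromℕ-cancel-≤ λ q q∈ →
        -≤⇒≤+ (f (m n)) c k (proj₂ (proj₂ (complex (m n)))) q (IsRounding.lower f≈F (m n) q q∈)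

  -- Avoidance is required at every argument of ψ. Since ψ may depend on `X`, it is taken to be the
  -- restriction to arguments from the bound `N` for this `X` on.
  avoids : ∀ {X} → X ∈ COMPLEX U f → ∃ λ ψ → LinearlyUniversal ψ × ¬ (∃ λ n → φ ψ n ⌜ X ↾ m n ⌝)
  avoids X-complex =
    let N , eventually = eventually-avoids X-complex
        ψ , ψ-linear , ψ-spec = universal-partial-restricted U-universal N
    in ψ , ψ-linear , λ { (n , ψ↓) → eventually n (proj₁ (ψ-spec ψ↓)) (proj₂ (ψ-spec ψ↓)) }

mainTheorem11 : (em : ExcludedMiddle 0ℓ) →
    (U : Code ⊥ 1) → Universal U →
    (f h ĥ : ℕ → ℝ) →
    (f-order : IsOrderFunction f) → SubIdentical f →
    IsOrderFunction h → NonNegative h →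
    IsOrderFunction ĥ → NonNegative ĥ →
    Σ[ (λ n → exp₂ (- h n)) ]<∞ →
    Σ[ (λ n → exp₂ (- ĥ n)) ]<∞ →
    TendsTo∞ (λ n → h n - ĥ n) →
    LUA (λ n → exp₂ (fromℕ (inv em f (IsOrderFunction.unbounded f-order) (h n) ℕ.+ 1)))
    ≤ₛ asBaire (COMPLEX U f)
mainTheorem11 em U U-universal f h ĥ f-order (f≥0 , _) h-order h≥0 ĥ-order ĥ≥0 _ Σĥ<∞ h-ĥ→∞ =
  let F , f≈F = round f (computable f-order) f≥0
      H , h≈H = round h (computable h-order) h≥0
      G , ĥ≈G = round ĥ (computable ĥ-order) ĥ≥0
      m , m-rec , H≤F , m≤inv = approximate-inverse f h f≈F h≈H em (unbounded f-order)
  in comp prefix-code (relativize (proj₁ m-rec) ∷ []) , λ { Y (X , X-complex , Y≡X) →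
    (λ n → ⌜ X ↾ m n ⌝) ,
    ((λ n → ⌜↾⌝<exp₂ X (m≤inv n)) ,
     avoids U-universal f h ĥ f≈F h≈H ĥ≈G (nondecreasing ĥ-order) Σĥ<∞ h-ĥ→∞ H≤F X-complex) ,
    λ n → ⇓comp (relativize-⇓ (proj₂ m-rec n) ∷ []) (prefix-code-⇓ Y≡X (m n)) }
  where open IsOrderFunction
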